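{- For all $n,k\ge 1$, the set of permutations $w\in\mathcal{L}_{n,k}(12\cdots(k+2))$ such that $w^{ -1}\in\mathcal{L}_{n,k}(12\cdots(k+2))$ is in bijection with $S_n(12\cdots(k+2))$.
   Context: A word $w$ contains a pattern $p\in S_m$ if some subsequence of $w$ of length $m$ is order-isomorphic to $p$; otherwise $w$ avoids $p$; $S(p)$ is the set of elements of $S$ avoiding $p$, and $S_n$ is the set of all permutations of $[n]$. For $n,k\ge 1$, $\mathcal{L}_{n,k}\subseteq S_{nk}$ is the set of permutations $w=w_{1,1}\cdots w_{1,k}w_{2,1}\cdots w_{n,k}$ such that (L1) $w_{i,j}<w_{i,j+1}$ for $1\le i\le n$, $1\le j\le k-1$, and (L2) $w_{i,j+1}>w_{i+1,j}$ for $1\le i\le n-1$, $1\le j\le k-1$. -}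

module Defs where

open import Level using (0ℓ)
open import Data.Nat using (ℕ; suc; _*_; _+_)
open import Data.Fin using (Fin; toℕ; combine; _<_)
open import Data.Fin.Permutation using (Permutation′; _⟨$⟩ʳ_; flip; id)
open import Data.Product using (Σ; _×_; proj₁)
open import Relation.Nullary using (¬_)
open import Relation.Binary.Bundles using (Setoid)
open import Relation.Binary.PropositionalEquality using (_→-setoid_; _≡_)
import Relation.Binary.Construct.On as On

-- A permutation w ∈ S_N is written in one-line notation as the word
-- w ⟨$⟩ʳ 0, w ⟨$⟩ʳ 1, …, w ⟨$⟩ʳ (N-1)  (values and positions in Fin N,
-- i.e. shifted down by one from [N]; order is unaffected).

_⁻¹ : ∀ {N} → Permutation′ N → Permutation′ N
w ⁻¹ = flip w

Contains : ∀ {N m} → Permutation′ N → Permutation′ m → Set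
Contains {N} {m} w p =
  Σ (Fin m → Fin N) λ f →
    (∀ a b → a < b → f a < f b) ×
    (∀ a b → ((w ⟨$⟩ʳ f a) < (w ⟨$⟩ʳ f b) → (p ⟨$⟩ʳ a) < (p ⟨$⟩ʳ b)) ×
             ((p ⟨$⟩ʳ a) < (p ⟨$⟩ʳ b) → (w ⟨$⟩ʳ f a) < (w ⟨$⟩ʳ f b)))

Avoids : ∀ {N m} → Permutation′ N → Permutation′ m → Set
Avoids w p = ¬ Contains w p

incr : (m : ℕ) → Permutation′ m
incr m = id

-- Entry w_{i,j} of w ∈ S_{nk}, with 0-based i < n, j < k, i.e. the entry
-- at (0-based) position k*i + j.
entry : ∀ {n k} → Permutation′ (n * k) → Fin n → Fin k → Fin (n * k)
entry w i j = w ⟨$⟩ʳ combine i j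

InL : ∀ n k → Permutation′ (n * k) → Set
InL n k w =
  (∀ (i : Fin n) (j j' : Fin k) → suc (toℕ j) ≡ toℕ j' →
     entry w i j < entry w i j') ×
  (∀ (i i' : Fin n) (j j' : Fin k) → suc (toℕ i) ≡ toℕ i' →
     suc (toℕ j) ≡ toℕ j' →
     entry w i' j < entry w i j')


-- A subset of S_N, viewed as a setoid: elements are permutations together
-- with a proof of membership; two elements are equal when the underlying
-- permutations agree pointwise.
SubPerm : (N : ℕ) → (Permutation′ N → Set) → Setoid 0ℓ 0ℓ
SubPerm N P = On.setoid {B = Σ (Permutation′ N) P} (Fin N →-setoid Fin N)
                (λ x → proj₁ x ⟨$⟩ʳ_)

LInvSet : ℕ → ℕ → Setoid 0ℓ 0ℓ
LInvSet n k = SubPerm (n * k) λ w →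
  (InL n k w × Avoids w (incr (k + 2))) ×
  (InL n k (w ⁻¹) × Avoids (w ⁻¹) (incr (k + 2)))

SAvoid : ℕ → ℕ → Setoid 0ℓ 0ℓ
SAvoid n k = SubPerm n λ σ → Avoids σ (incr (k + 2))

{-# OPTIONS --safe #-}
-- A permutation w that is increasing on blocks of k consecutive positions and of k
-- consecutive values is determined by the n × n matrix A counting its points in the
-- cells of the block grid.  All line sums of A are k, and the longest increasing
-- subsequence of w is the maximal weight of a south-east path in A, that is, the
-- first part of the RSK shape of A.  RSK turns A into two chains of interlacing
-- partitions with a common last member.  When the first part is at most M, replacing
-- the i-th member by its complement in an i × M box keeps these properties, so
-- it induces an involution on the matrices with path weight at most M, and this
-- involution replaces every line sum s by M − s.  With M = k + 1 it exchanges the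
-- line sums k and 1, and matrices with line sums 1 are the permutations of [n].
-- Condition (L2) is automatic: a violation creates an increasing subsequence of length k + 2.
module Submission where

open import Defs
open import Data.Nat
open import Data.Nat.Properties
open import Data.Nat.DivMod
open import Data.Nat.Induction using (<-wellFounded)
open import Data.Nat.Tactic.RingSolver using (solve-∀)
open import Data.Fin as Fin using (Fin; toℕ; fromℕ<; combine)
open import Data.Fin.Properties as Fin using (toℕ-fromℕ<; toℕ<n; toℕ-injective)
open import Data.Fin.Permutation
  using (Permutation′; _⟨$⟩ʳ_; _⟨$⟩ˡ_; flip; permutation; inverseˡ; inverseʳ)
open import Data.List using (List; []; _∷_; _++_; length; lookup; tabulate)
open import Data.List.Properties using (length-++; length-tabulate)
open import Data.List.Membership.Propositional.Properties using (∈-lookup)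
open import Data.List.Relation.Unary.All as All using (All; []; _∷_)
import Data.List.Relation.Unary.All.Properties as All
open import Data.List.Relation.Unary.AllPairs using (AllPairs; []; _∷_)
import Data.List.Relation.Unary.AllPairs.Properties as AllPairs
open import Data.Product using (_×_; _,_; proj₁; proj₂; ∃; ∃₂; swap)
open import Data.Sum using (_⊎_; inj₁; inj₂)
open import Algebra.Properties.CommutativeMonoid.Sum +-0-commutativeMonoid
  using (sum; sum-syntax; ∑-comm; ∑-distrib-+; sum-cong-≗; ∑-permute; sum-replicate-zero)
open import Algebra.Properties.CommutativeSemigroup +-commutativeSemigroup using (interchange)
open import Function using (Injective; _∘_)
open import Function.Bundles using (Inverse)
open import Induction.WellFounded using (Acc; acc)
open import Level using (0ℓ)
open import Relation.Binary using (Rel; tri<; tri≈; tri>)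
open import Relation.Nullary using (Dec; yes; no; contradiction; ¬_)
open import Relation.Nullary.Decidable using (_×-dec_)
open import Relation.Binary.PropositionalEquality

-- RSK by growth diagrams

Matrix : Set
Matrix = ℕ → ℕ → ℕ

transpose : Matrix → Matrix
transpose A i j = A j i

Agree : ℕ → Matrix → Matrix → Set
Agree n A B = ∀ {i j} → i < n → j < n → A i j ≡ B i j

sumTo : (ℕ → ℕ) → ℕ → ℕ
sumTo f zero    = 0
sumTo f (suc m) = sumTo f m + f m

sumTo-cong : ∀ {f g} m → (∀ {x} → x < m → f x ≡ g x) → sumTo f m ≡ sumTo g m
sumTo-cong zero    _  = refl
sumTo-cong (suc m) eq = cong₂ _+_ (sumTo-cong m (λ x<m → eq (m<n⇒m<1+n x<m))) (eq ≤-refl)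

sumTo-sucˡ : ∀ f m → sumTo f (suc m) ≡ f 0 + sumTo (λ x → f (suc x)) m
sumTo-sucˡ f zero    = +-comm 0 (f 0)
sumTo-sucˡ f (suc m) = trans (cong (_+ f (suc m)) (sumTo-sucˡ f m)) (+-assoc (f 0) _ _)

sumTo-reverse : ∀ f m → sumTo (λ x → f (m ∸ suc x)) m ≡ sumTo f m
sumTo-reverse f zero    = refl
sumTo-reverse f (suc m) = begin
  sumTo (λ x → f (m ∸ x)) (suc m)             ≡⟨ sumTo-sucˡ (λ x → f (m ∸ x)) m ⟩
  f m + sumTo (λ x → f (m ∸ suc x)) m         ≡⟨ cong (f m +_) (sumTo-reverse f m) ⟩
  f m + sumTo f m                             ≡⟨ +-comm (f m) _ ⟩
  sumTo f m + f m                             ∎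
  where open ≡-Reasoning

-- Piecewise-linear local rule of the Robinson–Schensted–Knuth correspondence;
-- the truncated subtraction is exact because toggle is only used with z ≤ x ⊓ y.
toggle : (u v x y z : ℕ) → ℕ
toggle u v x y z = (u ⊔ v) + ((x ⊓ y) ∸ z)

toggle-upper : ∀ u v x y z → u ⊔ v ≤ z → z ≤ x ⊓ y → toggle u v x y z ≤ x ⊓ y
toggle-upper u v x y z h k = ≤-trans (+-monoˡ-≤ _ h) (≤-reflexive (m+[n∸m]≡n k))

toggle-sum : ∀ u v x y z → z ≤ x ⊓ y → toggle u v x y z + z ≡ (u ⊔ v) + (x ⊓ y)
toggle-sum u v x y z k = trans (+-assoc (u ⊔ v) _ _) (cong ((u ⊔ v) +_) (m∸n+n≡m k))

-- `z` and its toggle have the fixed sum `(u ⊔ v) + (x ⊓ y)`, so toggling again must return `z`.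
toggle-involutive : ∀ u v x y z → u ⊔ v ≤ z → z ≤ x ⊓ y →
                    toggle u v x y (toggle u v x y z) ≡ z
toggle-involutive u v x y z h k = +-cancelʳ-≡ (toggle u v x y z) _ _
  (trans (toggle-sum u v x y _ (toggle-upper u v x y z h k))
         (trans (sym (toggle-sum u v x y z k)) (+-comm (toggle u v x y z) z)))

toggle-cong : ∀ {u u' v v' x x' y y' z z'} → u ≡ u' → v ≡ v' → x ≡ x' → y ≡ y' → z ≡ z' →
              toggle u v x y z ≡ toggle u' v' x' y' z'
toggle-cong refl refl refl refl refl = refl

⊔-⊓-sum : ∀ a b → (a ⊔ b) + (a ⊓ b) ≡ a + b
⊔-⊓-sum a b with ≤-total a b
... | inj₁ a≤b = trans (cong₂ _+_ (m≤n⇒m⊔n≡n a≤b) (m≤n⇒m⊓n≡m a≤b)) (+-comm b a)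
... | inj₂ b≤a = cong₂ _+_ (m≥n⇒m⊔n≡m b≤a) (m≥n⇒m⊓n≡n b≤a)

-- Says that the skew shape `g / f` is a horizontal strip.
Interlace : (ℕ → ℕ) → (ℕ → ℕ) → Set
Interlace f g = ∀ r → f r ≤ g r × g (suc r) ≤ f r

interlace-cong : ∀ {f f' g g'} → f ≗ f' → g ≗ g' → Interlace f g → Interlace f' g'
interlace-cong ef eg h r = subst₂ _≤_ (ef r) (eg r) (proj₁ (h r)) ,
                           subst₂ _≤_ (eg (suc r)) (ef r) (proj₂ (h r))

-- Λ A i j r is the r-th part, counted from 0, of the RSK shape of the north-west
-- i × j submatrix of A; its part 0 is the maximal weight of a south-east path.
Λ : Matrix → ℕ → ℕ → ℕ → ℕ
Λ A zero    j       r       = 0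
Λ A (suc i) zero    r       = 0
Λ A (suc i) (suc j) zero    = (Λ A i (suc j) 0 ⊔ Λ A (suc i) j 0) + A i j
Λ A (suc i) (suc j) (suc r) =
  toggle (Λ A i (suc j) (suc r)) (Λ A (suc i) j (suc r))
         (Λ A i (suc j) r) (Λ A (suc i) j r) (Λ A i j r)

Λ-zeroʳ : ∀ A i r → Λ A i 0 r ≡ 0
Λ-zeroʳ A zero    r = refl
Λ-zeroʳ A (suc i) r = refl

-- The local rule is symmetric in its two neighbours. Statements about columns thereby reduce to
-- statements about rows.
Λ-transpose : ∀ A i j r → Λ (transpose A) j i r ≡ Λ A i j r
Λ-transpose A zero    j       r       = Λ-zeroʳ (transpose A) j r
Λ-transpose A (suc i) zero    r       = refl
Λ-transpose A (suc i) (suc j) zero    = cong (_+ A i j)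
  (trans (⊔-comm (Λ (transpose A) j (suc i) 0) _)
         (cong₂ _⊔_ (Λ-transpose A i (suc j) 0) (Λ-transpose A (suc i) j 0)))
Λ-transpose A (suc i) (suc j) (suc r) = cong₂ _+_
  (trans (⊔-comm (Λ (transpose A) j (suc i) (suc r)) _)
         (cong₂ _⊔_ (Λ-transpose A i (suc j) (suc r)) (Λ-transpose A (suc i) j (suc r))))
  (cong₂ _∸_
    (trans (⊓-comm (Λ (transpose A) j (suc i) r) _)
           (cong₂ _⊓_ (Λ-transpose A i (suc j) r) (Λ-transpose A (suc i) j r)))
    (Λ-transpose A i j r))

Λ-cong : ∀ {n A B} → Agree n A B → ∀ {i j} → i ≤ n → j ≤ n → ∀ r → Λ A i j r ≡ Λ B i j r
Λ-cong eq {zero}  {j}     p q r       = refl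
Λ-cong eq {suc i} {zero}  p q r       = refl
Λ-cong eq {suc i} {suc j} p q zero    =
  cong₂ _+_ (cong₂ _⊔_ (Λ-cong eq (<⇒≤ p) q 0) (Λ-cong eq p (<⇒≤ q) 0)) (eq p q)
Λ-cong eq {suc i} {suc j} p q (suc r) =
  toggle-cong (Λ-cong eq (<⇒≤ p) q (suc r)) (Λ-cong eq p (<⇒≤ q) (suc r))
              (Λ-cong eq (<⇒≤ p) q r) (Λ-cong eq p (<⇒≤ q) r) (Λ-cong eq (<⇒≤ p) (<⇒≤ q) r)

mutual
  -- Interlacing across the north and west edges of a cell bounds the toggled part, and these bounds
  -- give interlacing across its south and east edges; hence the mutual induction.
  Λ-interlaceᵛ : ∀ A i j → Interlace (Λ A i j) (Λ A (suc i) j)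
  Λ-interlaceᵛ A i zero r rewrite Λ-zeroʳ A i r = z≤n , z≤n
  Λ-interlaceᵛ A i (suc j) r = lower A i j r , ≤-trans (upper A i j r) (m⊓n≤m (Λ A i (suc j) r) _)
    where
    lower : ∀ A i j r → Λ A i (suc j) r ≤ Λ A (suc i) (suc j) r
    lower A i j zero    = ≤-trans (m≤m⊔n _ (Λ A (suc i) j 0)) (m≤m+n _ (A i j))
    lower A i j (suc r) = ≤-trans (m≤m⊔n _ (Λ A (suc i) j (suc r))) (m≤m+n _ _)

  Λ-interlaceʰ : ∀ A i j → Interlace (Λ A i j) (Λ A i (suc j))
  Λ-interlaceʰ A zero    j r = z≤n , z≤n
  Λ-interlaceʰ A (suc i) j r = lower r , ≤-trans (upper A i j r) (m⊓n≤n (Λ A i (suc j) r) _)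
    where
    lower : ∀ r → Λ A (suc i) j r ≤ Λ A (suc i) (suc j) r
    lower zero    = ≤-trans (m≤n⊔m (Λ A i (suc j) 0) _) (m≤m+n _ (A i j))
    lower (suc r) = ≤-trans (m≤n⊔m (Λ A i (suc j) (suc r)) _) (m≤m+n _ _)

  ⊔≤Λ≤⊓ : ∀ A i j r → (Λ A i (suc j) (suc r) ⊔ Λ A (suc i) j (suc r)) ≤ Λ A i j r ×
                       Λ A i j r ≤ (Λ A i (suc j) r ⊓ Λ A (suc i) j r)
  ⊔≤Λ≤⊓ A i j r = ⊔-lub (proj₂ (Λ-interlaceʰ A i j r)) (proj₂ (Λ-interlaceᵛ A i j r)) ,
                  ⊓-glb (proj₁ (Λ-interlaceʰ A i j r)) (proj₁ (Λ-interlaceᵛ A i j r))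

  upper : ∀ A i j r → Λ A (suc i) (suc j) (suc r) ≤ Λ A i (suc j) r ⊓ Λ A (suc i) j r
  upper A i j r = toggle-upper (Λ A i (suc j) (suc r)) _ _ _ (Λ A i j r)
                    (proj₁ (⊔≤Λ≤⊓ A i j r)) (proj₂ (⊔≤Λ≤⊓ A i j r))

-- By interlacing, each new row adds at most one part.
Λ-vanish : ∀ A i j {r} → i ≤ r → Λ A i j r ≡ 0
Λ-vanish A zero    j _         = refl
Λ-vanish A (suc i) j (s≤s i≤r) =
  n≤0⇒n≡0 (≤-trans (proj₂ (Λ-interlaceᵛ A i j _)) (≤-reflexive (Λ-vanish A i j i≤r)))

Λ-monoⁱ : ∀ A {i i'} j r → i ≤′ i' → Λ A i j r ≤ Λ A i' j r
Λ-monoⁱ A j r ≤′-refl     = ≤-refl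
Λ-monoⁱ A j r (≤′-step p) = ≤-trans (Λ-monoⁱ A j r p) (proj₁ (Λ-interlaceᵛ A _ j r))

Λ-mono : ∀ A {i i' j j'} r → i ≤ i' → j ≤ j' → Λ A i j r ≤ Λ A i' j' r
Λ-mono A {i} {i'} {j} {j'} r p q = ≤-trans (Λ-monoⁱ A j r (≤⇒≤′ p))
  (subst₂ _≤_ (Λ-transpose A i' j r) (Λ-transpose A i' j' r) (Λ-monoⁱ (transpose A) i' r (≤⇒≤′ q)))

Λ≤Λ₀ : ∀ A i j r → Λ A i j r ≤ Λ A i j 0
Λ≤Λ₀ A i j zero    = ≤-refl
Λ≤Λ₀ A i j (suc r) = ≤-trans (≤-trans (proj₁ (Λ-interlaceᵛ A i j (suc r)))
                                      (proj₂ (Λ-interlaceᵛ A i j r)))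
                             (Λ≤Λ₀ A i j r)

size : Matrix → ℕ → ℕ → ℕ
size A i j = sumTo (Λ A i j) i

-- The local rule preserves sizes up to the new entry: at each part, the maximum and the minimum of
-- the two neighbours together give their sum.
size-local : ∀ A i j → size A (suc i) (suc j) + size A i j ≡
                       A i j + (size A i (suc j) + size A (suc i) j)
size-local A i j = begin
  size A (suc i) (suc j) + size A i j
    ≡⟨ telescope i ⟩
  A i j + (sumTo μ i + sumTo κ i + (μ i ⊔ κ i))
    ≡⟨ cong (λ z → A i j + (sumTo μ i + sumTo κ i + (z ⊔ κ i))) (Λ-vanish A i (suc j) ≤-refl) ⟩
  A i j + (sumTo μ i + sumTo κ i + κ i)
    ≡⟨ cong (A i j +_) (+-assoc (sumTo μ i) _ _) ⟩
  A i j + (size A i (suc j) + size A (suc i) j) ∎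
  where
  open ≡-Reasoning
  μ = Λ A i (suc j)
  κ = Λ A (suc i) j
  λ′ = Λ A i j
  ν = Λ A (suc i) (suc j)
  -- The maximum left over at `R` meets the minimum in the toggle of part `suc R`. At `R = i` the
  -- shape `μ` has run out of parts, so what remains is the last part of `κ`.
  telescope : ∀ R → sumTo ν (suc R) + sumTo λ′ R ≡ A i j + (sumTo μ R + sumTo κ R + (μ R ⊔ κ R))
  telescope zero    = trans (+-identityʳ _) (+-comm (μ 0 ⊔ κ 0) (A i j))
  telescope (suc R) = begin
    sumTo ν (suc R) + ν (suc R) + (sumTo λ′ R + λ′ R)
      ≡⟨ interchange (sumTo ν (suc R)) (ν (suc R)) (sumTo λ′ R) (λ′ R) ⟩
    (sumTo ν (suc R) + sumTo λ′ R) + (ν (suc R) + λ′ R)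
      ≡⟨ cong₂ _+_ (telescope R) (toggle-sum (μ (suc R)) (κ (suc R)) (μ R) (κ R) (λ′ R)
                                             (proj₂ (⊔≤Λ≤⊓ A i j R))) ⟩
    A i j + (sumTo μ R + sumTo κ R + (μ R ⊔ κ R)) + ((μ (suc R) ⊔ κ (suc R)) + (μ R ⊓ κ R))
      ≡⟨ regroup (A i j) (sumTo μ R) (sumTo κ R) (μ R ⊔ κ R) (μ (suc R) ⊔ κ (suc R)) (μ R ⊓ κ R) ⟩
    A i j + (sumTo μ R + sumTo κ R + ((μ R ⊔ κ R) + (μ R ⊓ κ R)) + (μ (suc R) ⊔ κ (suc R)))
      ≡⟨ cong (λ z → A i j + (sumTo μ R + sumTo κ R + z + (μ (suc R) ⊔ κ (suc R))))
              (⊔-⊓-sum (μ R) (κ R)) ⟩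
    A i j + (sumTo μ R + sumTo κ R + (μ R + κ R) + (μ (suc R) ⊔ κ (suc R)))
      ≡⟨ cong (λ z → A i j + (z + (μ (suc R) ⊔ κ (suc R)))) (interchange (sumTo μ R) (sumTo κ R) (μ R) (κ R)) ⟩
    A i j + (sumTo μ (suc R) + sumTo κ (suc R) + (μ (suc R) ⊔ κ (suc R))) ∎
    where
    regroup : ∀ a b c d e f → a + (b + c + d) + (e + f) ≡ a + (b + c + (d + f) + e)
    regroup = solve-∀

-- Sizes along the chain of shapes determine the row sums; this is how complementing shapes acts on
-- line sums.
size-row : ∀ A i j → size A (suc i) j ≡ size A i j + sumTo (A i) j
size-row A i zero = trans (vanish (suc i)) (sym (trans (+-identityʳ _) (vanish i)))
  where
  zeros : ∀ {f} m → (∀ r → f r ≡ 0) → sumTo f m ≡ 0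
  zeros zero    h = refl
  zeros (suc m) h = cong₂ _+_ (zeros m h) (h m)
  vanish : ∀ i → size A i 0 ≡ 0
  vanish i = zeros i (Λ-zeroʳ A i)
size-row A i (suc j) = +-cancelʳ-≡ (size A i j) _ _ (begin
  size A (suc i) (suc j) + size A i j
    ≡⟨ size-local A i j ⟩
  A i j + (size A i (suc j) + size A (suc i) j)
    ≡⟨ cong (λ z → A i j + (size A i (suc j) + z)) (size-row A i j) ⟩
  A i j + (size A i (suc j) + (size A i j + sumTo (A i) j))
    ≡⟨ regroup (A i j) (size A i (suc j)) (size A i j) (sumTo (A i) j) ⟩
  size A i (suc j) + (sumTo (A i) j + A i j) + size A i j ∎)
  where
  open ≡-Reasoning
  regroup : ∀ a b c d → a + (b + (c + d)) ≡ b + (d + a) + c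
  regroup = solve-∀

extract-eq : ∀ {n a b i j} → a + suc i ≡ n → b + suc j ≡ n → n ∸ suc i ≡ a × n ∸ suc j ≡ b
extract-eq {a = a} {b} {i} {j} refl q = m+n∸n≡m a (suc i) , trans (cong (_∸ suc j) (sym q)) (m+n∸n≡m b (suc j))

-- Backward growth from the south and east boundary; H a b is the shape at (n ∸ a , n ∸ b).
module Backward (n : ℕ) (P Q : ℕ → ℕ → ℕ) where

  H : ℕ → ℕ → ℕ → ℕ
  H zero    b       r = Q (n ∸ b) r
  H (suc a) zero    r = P (n ∸ suc a) r
  -- The local rule solved for the north-west shape: its part `r` is the toggle of part `suc r` of
  -- the south-east shape.
  H (suc a) (suc b) r = toggle (H (suc a) b (suc r)) (H a (suc b) (suc r))
                               (H (suc a) b r) (H a (suc b) r) (H a b (suc r))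

  -- The forward rule for part `0` adds the entry to the larger neighbour, so the entry is the
  -- excess.
  corner : ℕ → ℕ → ℕ
  corner a b = H a b 0 ∸ (H (suc a) b 0 ⊔ H a (suc b) 0)

  extract : Matrix
  extract i j = corner (n ∸ suc i) (n ∸ suc j)

  extract-corner : ∀ {a b i j} → a + suc i ≡ n → b + suc j ≡ n → extract i j ≡ corner a b
  extract-corner {a} {b} {i} {j} p q =
    cong₂ corner (proj₁ (extract-eq p q)) (proj₂ (extract-eq p q))

  module _ (A : Matrix) (P≡ : ∀ {i} → i ≤ n → ∀ r → P i r ≡ Λ A i n r)
           (Q≡ : ∀ {j} → j ≤ n → ∀ r → Q j r ≡ Λ A n j r) where

    index : ∀ {a i} → a + i ≡ n → n ∸ a ≡ i
    index {a} {i} refl = m+n∸m≡n a i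

    -- Starting from the boundary of a growth diagram, backward growth retraces it because the local
    -- rule is an involution.
    H≡Λ : ∀ a b {i j} → a + i ≡ n → b + j ≡ n → ∀ r → H a b r ≡ Λ A i j r
    H≡Λ zero b {i} {j} refl q r =
      trans (cong (λ z → Q z r) (index q)) (Q≡ (m+n≤o⇒n≤o b (≤-reflexive q)) r)
    H≡Λ (suc a) zero {i} p refl r =
      trans (cong (λ z → P z r) (index p)) (P≡ (m+n≤o⇒n≤o (suc a) (≤-reflexive p)) r)
    H≡Λ (suc a) (suc b) {i} {j} p q r = trans
      (toggle-cong (H≡Λ (suc a) b p q' (suc r)) (H≡Λ a (suc b) p' q (suc r))
                   (H≡Λ (suc a) b p q' r) (H≡Λ a (suc b) p' q r) (H≡Λ a b p' q' (suc r)))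
      (toggle-involutive (Λ A i (suc j) (suc r)) _ _ _ _
                         (proj₁ (⊔≤Λ≤⊓ A i j r)) (proj₂ (⊔≤Λ≤⊓ A i j r)))
      where
      p' = trans (+-suc a i) p
      q' = trans (+-suc b j) q

    -- Injectivity of RSK: the two boundary chains recover the matrix.
    extract-Λ : Agree n extract A
    extract-Λ {i} {j} i<n j<n = trans (extract-corner p q) (trans
      (cong₂ _∸_ (H≡Λ a b p q 0)
        (cong₂ _⊔_ (H≡Λ (suc a) b p⁺ q 0) (H≡Λ a (suc b) p q⁺ 0)))
      (m+n∸m≡n (Λ A i (suc j) 0 ⊔ Λ A (suc i) j 0) (A i j)))
      where
      a = n ∸ suc i
      b = n ∸ suc j
      p : a + suc i ≡ n
      p = m∸n+n≡m i<n
      q : b + suc j ≡ n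
      q = m∸n+n≡m j<n
      p⁺ = trans (sym (+-suc a i)) p
      q⁺ = trans (sym (+-suc b j)) q

  module _ (P₀ : P 0 ≗ λ _ → 0) (Q₀ : Q 0 ≗ λ _ → 0) (P≗Q : P n ≗ Q n)
           (P≺ : ∀ {i} → i < n → Interlace (P i) (P (suc i)))
           (Q≺ : ∀ {j} → j < n → Interlace (Q j) (Q (suc j))) where

    H-zeroʳ : ∀ a r → H a 0 r ≡ P (n ∸ a) r
    H-zeroʳ zero    r = sym (P≗Q r)
    H-zeroʳ (suc a) r = refl

    private
      step : ∀ {a} → a < n → suc (n ∸ suc a) ≡ n ∸ a
      step {a} a<n = sym (+-∸-assoc 1 a<n)

    mutual
      -- Mirror image of the forward induction: interlacing across the south and east edges of a
      -- cell passes to its north and west edges.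
      H-interlaceᵛ : ∀ {a} b → a < n → b ≤ n → Interlace (H (suc a) b) (H a b)
      H-interlaceᵛ {a} zero    a<n b≤n =
        interlace-cong (λ _ → refl) (λ r → trans (cong (λ z → P z r) (step a<n)) (sym (H-zeroʳ a r)))
                       (P≺ (∸-monoʳ-< (s≤s z≤n) a<n))
      H-interlaceᵛ {a} (suc b) a<n b<n r =
        ≤-trans (H-upper a<n b<n r) (m⊓n≤n (H (suc a) b r) _) ,
        ≤-trans (m≤n⊔m (H (suc a) b (suc r)) _) (m≤m+n _ _)

      H-interlaceʰ : ∀ a {b} → a ≤ n → b < n → Interlace (H a (suc b)) (H a b)
      H-interlaceʰ zero {b} a≤n b<n =
        interlace-cong (λ _ → refl) (λ r → cong (λ z → Q z r) (step b<n))
                       (Q≺ (∸-monoʳ-< (s≤s z≤n) b<n))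
      H-interlaceʰ (suc a) {b} a<n b<n r =
        ≤-trans (H-upper a<n b<n r) (m⊓n≤m (H (suc a) b r) _) ,
        ≤-trans (m≤m⊔n _ (H a (suc b) (suc r))) (m≤m+n _ _)

      ⊔≤H≤⊓ : ∀ {a b} → a < n → b < n → ∀ r →
        H (suc a) b (suc r) ⊔ H a (suc b) (suc r) ≤ H a b (suc r) ×
        H a b (suc r) ≤ H (suc a) b r ⊓ H a (suc b) r
      ⊔≤H≤⊓ {a} {b} a<n b<n r =
        ⊔-lub (proj₁ (H-interlaceᵛ b a<n (<⇒≤ b<n) (suc r))) (proj₁ (H-interlaceʰ a (<⇒≤ a<n) b<n (suc r))) ,
        ⊓-glb (proj₂ (H-interlaceᵛ b a<n (<⇒≤ b<n) r)) (proj₂ (H-interlaceʰ a (<⇒≤ a<n) b<n r))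

      H-upper : ∀ {a b} → a < n → b < n → ∀ r → H (suc a) (suc b) r ≤ H (suc a) b r ⊓ H a (suc b) r
      H-upper {a} {b} a<n b<n r =
        toggle-upper (H (suc a) b (suc r)) _ _ _ _ (proj₁ (⊔≤H≤⊓ a<n b<n r)) (proj₂ (⊔≤H≤⊓ a<n b<n r))

    -- Shapes shrink towards the west, and the north-east corner is the empty `P 0`.
    H-top : ∀ b → b ≤ n → ∀ r → H n b r ≡ 0
    H-top zero    _   r = trans (H-zeroʳ n r) (trans (cong (λ z → P z r) (n∸n≡0 n)) (P₀ r))
    H-top (suc b) b<n r = n≤0⇒n≡0
      (≤-trans (proj₁ (H-interlaceʰ n ≤-refl b<n r)) (≤-reflexive (H-top b (<⇒≤ b<n) r)))

    H-left : ∀ a → a ≤ n → ∀ r → H a n r ≡ 0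
    H-left zero    _   r = trans (cong (λ z → Q z r) (n∸n≡0 n)) (Q₀ r)
    H-left (suc a) a<n r = n≤0⇒n≡0
      (≤-trans (proj₁ (H-interlaceᵛ n a<n ≤-refl r)) (≤-reflexive (H-left a (<⇒≤ a<n) r)))

    -- Surjectivity of RSK: any two interlacing chains that start empty and share their last member
    -- bound a growth diagram. Its north and west edges are empty, and forward growth undoes each
    -- backward toggle.
    Λ-extract : ∀ i j {a b} → a + i ≡ n → b + j ≡ n → ∀ r → Λ extract i j r ≡ H a b r
    Λ-extract zero j {a} {b} p q r
      rewrite trans (sym (+-identityʳ a)) p = sym (H-top b (m+n≤o⇒m≤o b (≤-reflexive q)) r)
    Λ-extract (suc i) zero {a} {b} p q r
      rewrite trans (sym (+-identityʳ b)) q = sym (H-left a (m+n≤o⇒m≤o a (≤-reflexive p)) r)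
    Λ-extract (suc i) (suc j) {a} {b} p q = go
      where
      p⁺ = trans (sym (+-suc a i)) p
      q⁺ = trans (sym (+-suc b j)) q
      a<n = m+n≤o⇒m≤o (suc a) (≤-reflexive p⁺)
      b<n = m+n≤o⇒m≤o (suc b) (≤-reflexive q⁺)
      go : ∀ r → Λ extract (suc i) (suc j) r ≡ H a b r
      go zero = trans
        (cong₂ _+_ (cong₂ _⊔_ (Λ-extract i (suc j) p⁺ q 0) (Λ-extract (suc i) j p q⁺ 0))
                   (extract-corner p q))
        (m+[n∸m]≡n (⊔-lub (proj₁ (H-interlaceᵛ b a<n (<⇒≤ b<n) 0))
                          (proj₁ (H-interlaceʰ a (<⇒≤ a<n) b<n 0))))
      go (suc r) = trans
        (toggle-cong (Λ-extract i (suc j) p⁺ q (suc r)) (Λ-extract (suc i) j p q⁺ (suc r))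
                     (Λ-extract i (suc j) p⁺ q r) (Λ-extract (suc i) j p q⁺ r)
                     (Λ-extract i j p⁺ q⁺ r))
        (toggle-involutive (H (suc a) b (suc r)) _ _ _ _
                           (proj₁ (⊔≤H≤⊓ a<n b<n r)) (proj₂ (⊔≤H≤⊓ a<n b<n r)))

-- Complementation of shapes

-- Rotated complement in a box with N columns: row i of a family of shapes has i parts.
complement : ℕ → (ℕ → ℕ → ℕ) → ℕ → ℕ → ℕ
complement N P i r with r <? i
... | yes _ = N ∸ P i (i ∸ suc r)
... | no  _ = 0

complement-< : ∀ N P {i r} → r < i → complement N P i r ≡ N ∸ P i (i ∸ suc r)
complement-< N P {i} {r} r<i with r <? i
... | yes _   = refl
... | no  r≮i = contradiction r<i r≮i

complement-≥ : ∀ N P {i r} → i ≤ r → complement N P i r ≡ 0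
complement-≥ N P {i} {r} i≤r with r <? i
... | yes r<i = contradiction i≤r (<⇒≱ r<i)
... | no  _   = refl

complement-≤ : ∀ N P i r → complement N P i r ≤ N
complement-≤ N P i r with r <? i
... | yes _ = m∸n≤m N (P i (i ∸ suc r))
... | no  _ = z≤n

complement-cong : ∀ N {P P'} i → (∀ r → P i r ≡ P' i r) → ∀ r → complement N P i r ≡ complement N P' i r
complement-cong N i eq r with r <? i
... | yes _ = cong (N ∸_) (eq _)
... | no  _ = refl

complement-involutive : ∀ N P i → (∀ r → P i r ≤ N) → (∀ {r} → i ≤ r → P i r ≡ 0) →
                        ∀ r → complement N (complement N P) i r ≡ P i r
complement-involutive N P i bound vanish r with r <? i
... | no  r≮i = sym (vanish (≮⇒≥ r≮i))
... | yes r<i = begin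
  N ∸ complement N P i (i ∸ suc r)          ≡⟨ cong (N ∸_) (complement-< N P (∸-monoʳ-< (s≤s z≤n) r<i)) ⟩
  N ∸ (N ∸ P i (i ∸ suc (i ∸ suc r)))       ≡⟨ m∸[m∸n]≡n (bound _) ⟩
  P i (i ∸ suc (i ∸ suc r))                 ≡⟨ cong (P i) reflect ⟩
  P i r                                     ∎
  where
  open ≡-Reasoning
  reflect : i ∸ suc (i ∸ suc r) ≡ r
  reflect = trans (cong (i ∸_) (sym (+-∸-assoc 1 r<i))) (m∸[m∸n]≡n (<⇒≤ r<i))

-- The box gains one row from `i` to `suc i`, so reversing the order of the parts exchanges the two
-- inequalities of interlacing.
complement-interlace : ∀ N P i → Interlace (P i) (P (suc i)) →
                       Interlace (complement N P i) (complement N P (suc i))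
complement-interlace N P i h r with r <? i
... | no r≮i rewrite complement-≥ N P {suc i} {suc r} (s≤s (≮⇒≥ r≮i)) = z≤n , z≤n
... | yes r<i
  rewrite complement-< N P {suc i} {r} (m<n⇒m<1+n r<i)
        | complement-< N P {suc i} {suc r} (s≤s r<i)
        = ∸-monoʳ-≤ N (subst (λ z → P (suc i) z ≤ P i (i ∸ suc r)) (sym (+-∸-assoc 1 r<i)) (proj₂ (h _))) ,
          ∸-monoʳ-≤ N (proj₁ (h _))

complement-sum : ∀ N P i → (∀ r → P i r ≤ N) →
                 sumTo (complement N P i) i + sumTo (P i) i ≡ i * N
complement-sum N P i bound = trans
  (cong (_+ sumTo (P i) i) (trans (sumTo-cong i (complement-< N P)) (sumTo-reverse (λ x → N ∸ P i x) i)))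
  (cancel i)
  where
  regroup : ∀ a b c d → a + b + (c + d) ≡ (b + d) + (a + c)
  regroup = solve-∀
  cancel : ∀ m → sumTo (λ x → N ∸ P i x) m + sumTo (P i) m ≡ m * N
  cancel zero    = refl
  cancel (suc m) = trans (regroup (sumTo (λ x → N ∸ P i x) m) _ _ _)
                         (cong₂ _+_ (m∸n+n≡m (bound m)) (cancel m))

-- The duality on matrices of bounded path weight.

module _ (N n : ℕ) where

  rows cols : Matrix → ℕ → ℕ → ℕ
  rows A i = Λ A i n
  cols A j = Λ A n j

  dual : Matrix → Matrix
  dual A = Backward.extract n (complement N (rows A)) (complement N (cols A))

  -- The first part of the common last shape dominates all parts in both chains, so this one bound
  -- makes the subtractions in their complements exact.
  Bounded : Matrix → Set
  Bounded A = Λ A n n 0 ≤ N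

  -- From `i` to `suc i` the total size of two complementary shapes grows by `N`, and each size
  -- grows by a row sum. Column sums are covered by transposing both matrices.
  rowSum-complement : ∀ B A → (∀ {i} → i ≤ n → ∀ r → rows B i r ≡ complement N (rows A) i r) →
                      (∀ {i} → i ≤ n → ∀ r → rows A i r ≤ N) →
                      ∀ {i} → i < n → sumTo (B i) n + sumTo (A i) n ≡ N
  rowSum-complement B A B≡ A≤ {i} i<n = +-cancelˡ-≡ (i * N) _ _ (begin
    i * N + (sumTo (B i) n + sumTo (A i) n)
      ≡⟨ cong (_+ (sumTo (B i) n + sumTo (A i) n)) (total (<⇒≤ i<n)) ⟨
    size B i n + size A i n + (sumTo (B i) n + sumTo (A i) n)
      ≡⟨ interchange (size B i n) (size A i n) _ _ ⟩
    (size B i n + sumTo (B i) n) + (size A i n + sumTo (A i) n)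
      ≡⟨ cong₂ _+_ (size-row B i n) (size-row A i n) ⟨
    size B (suc i) n + size A (suc i) n
      ≡⟨ total i<n ⟩
    N + i * N
      ≡⟨ +-comm N _ ⟩
    i * N + N ∎)
    where
    open ≡-Reasoning
    total : ∀ {m} → m ≤ n → size B m n + size A m n ≡ m * N
    total {m} m≤n = trans (cong (_+ size A m n) (sumTo-cong m (λ {r} _ → B≡ m≤n r)))
                          (complement-sum N (rows A) m (A≤ m≤n))

  module _ {A : Matrix} (bounded : Bounded A) where

    rows≤N : ∀ {i} → i ≤ n → ∀ r → rows A i r ≤ N
    rows≤N {i} i≤n r = ≤-trans (Λ≤Λ₀ A i n r) (≤-trans (Λ-mono A {i} {n} {n} 0 i≤n ≤-refl) bounded)

    cols≤N : ∀ {j} → j ≤ n → ∀ r → cols A j r ≤ N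
    cols≤N {j} j≤n r = ≤-trans (Λ≤Λ₀ A n j r) (≤-trans (Λ-mono A {n} {n} {j} 0 ≤-refl j≤n) bounded)

    cols-vanish : ∀ j {r} → j ≤ r → cols A j r ≡ 0
    cols-vanish j {r} j≤r = trans (sym (Λ-transpose A n j r)) (Λ-vanish (transpose A) j n j≤r)

    open Backward n (complement N (rows A)) (complement N (cols A))

    private
      rows≺ : ∀ {i} → i < n → Interlace (complement N (rows A) i) (complement N (rows A) (suc i))
      rows≺ {i} _ = complement-interlace N (rows A) i (Λ-interlaceᵛ A i n)
      cols≺ : ∀ {j} → j < n → Interlace (complement N (cols A) j) (complement N (cols A) (suc j))
      cols≺ {j} _ = complement-interlace N (cols A) j (Λ-interlaceʰ A n j)
      rows≗cols = complement-cong N {rows A} {cols A} n (λ _ → refl)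
      Λ≡H = Λ-extract (λ _ → refl) (λ _ → refl) rows≗cols rows≺ cols≺
      H₀  = H-zeroʳ (λ _ → refl) (λ _ → refl) rows≗cols rows≺ cols≺

    -- The complemented chains start empty, interlace and end in the same shape, so they are the
    -- boundary of the extracted matrix.
    dual-rows : ∀ {i} → i ≤ n → ∀ r → rows (dual A) i r ≡ complement N (rows A) i r
    dual-rows {i} i≤n r = trans (Λ≡H i n (m∸n+n≡m i≤n) refl r)
      (trans (H₀ (n ∸ i) r) (cong (λ z → complement N (rows A) z r) (m∸[m∸n]≡n i≤n)))

    dual-cols : ∀ {j} → j ≤ n → ∀ r → cols (dual A) j r ≡ complement N (cols A) j r
    dual-cols {j} j≤n r = trans (Λ≡H n j refl (m∸n+n≡m j≤n) r)
      (cong (λ z → complement N (cols A) z r) (m∸[m∸n]≡n j≤n))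

    dual-bounded : Bounded (dual A)
    dual-bounded = ≤-trans (≤-reflexive (dual-rows ≤-refl 0)) (complement-≤ N (rows A) n 0)

    dual-rowSum : ∀ {i} → i < n → sumTo (dual A i) n + sumTo (A i) n ≡ N
    dual-rowSum = rowSum-complement (dual A) A dual-rows rows≤N

    dual-colSum : ∀ {j} → j < n → sumTo (transpose (dual A) j) n + sumTo (transpose A j) n ≡ N
    dual-colSum = rowSum-complement (transpose (dual A)) (transpose A)
      (λ {j} j≤n r → trans (Λ-transpose (dual A) n j r) (trans (dual-cols j≤n r)
        (complement-cong N j (λ r → sym (Λ-transpose A n j r)) r)))
      (λ {j} j≤n r → ≤-trans (≤-reflexive (Λ-transpose A n j r)) (cols≤N j≤n r))

    -- Complementing twice restores the chains of `A`, and these determine `A`. The matrix `C`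
    -- leaves room for one that agrees with the dual only on the `n × n` square, as counts of points
    -- do.
    dual-dual : ∀ {C} → Agree n C (dual A) → Agree n (dual C) A
    dual-dual {C} C≈ = Backward.extract-Λ n _ _ A
      (λ {i} i≤n r → trans
        (complement-cong N i (λ r → trans (Λ-cong C≈ i≤n ≤-refl r) (dual-rows i≤n r)) r)
        (complement-involutive N (rows A) i (rows≤N i≤n) (Λ-vanish A i n) r))
      (λ {j} j≤n r → trans
        (complement-cong N j (λ r → trans (Λ-cong C≈ ≤-refl j≤n r) (dual-cols j≤n r)) r)
        (complement-involutive N (cols A) j (cols≤N j≤n) (cols-vanish j) r))

    dual-cong : ∀ {C} → Agree n C A → Agree n (dual C) (dual A)
    dual-cong {C} C≈ = Backward.extract-Λ n _ _ (dual A)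
      (λ {i} i≤n r → trans (complement-cong N i (Λ-cong C≈ i≤n ≤-refl) r) (sym (dual-rows i≤n r)))
      (λ {j} j≤n r → trans (complement-cong N j (Λ-cong C≈ ≤-refl j≤n) r) (sym (dual-cols j≤n r)))

-- Counting points in cells

sumTo-mono : ∀ {f g} m → (∀ {x} → x < m → f x ≤ g x) → sumTo f m ≤ sumTo g m
sumTo-mono zero    h = z≤n
sumTo-mono (suc m) h = +-mono-≤ (sumTo-mono m (λ x<m → h (m<n⇒m<1+n x<m))) (h ≤-refl)

-- Turns a one-sided bound on counts into an equality once the totals are known.
sumTo-squeeze : ∀ {f g} m → (∀ {x} → x < m → f x ≤ g x) → sumTo g m ≤ sumTo f m →
                ∀ {x} → x < m → f x ≡ g x
sumTo-squeeze {f} {g} (suc m) h total {x} x<1+m with x ≟ m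
... | yes refl = ≤-antisym (h ≤-refl)
  (+-cancelˡ-≤ (sumTo f m) _ _ (≤-trans (+-monoˡ-≤ (g m) (sumTo-mono m (λ x<m → h (m<n⇒m<1+n x<m)))) total))
... | no x≢m = sumTo-squeeze m (λ y<m → h (m<n⇒m<1+n y<m))
  (+-cancelʳ-≤ (f m) _ _ (≤-trans (+-monoʳ-≤ (sumTo g m) (h ≤-refl)) total))
  (≤∧≢⇒< (≤-pred x<1+m) x≢m)

sumTo-const : ∀ c m → sumTo (λ _ → c) m ≡ m * c
sumTo-const c zero    = refl
sumTo-const c (suc m) = trans (+-comm _ c) (cong (c +_) (sumTo-const c m))

sumTo-lex : ∀ f {j j' s s'} → s < f j → j < j' → sumTo f j + s < sumTo f j' + s'
sumTo-lex f {j} {j'} {s} {s'} s<fj j<j' =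
  <-≤-trans (+-monoʳ-< (sumTo f j) s<fj) (≤-trans (mono (≤⇒≤′ j<j')) (m≤m+n _ s'))
  where
  mono : ∀ {a b} → a ≤′ b → sumTo f a ≤ sumTo f b
  mono ≤′-refl     = ≤-refl
  mono (≤′-step p) = ≤-trans (mono p) (m≤m+n _ _)

sumTo-locate : ∀ f m {r} → r < sumTo f m → ∃₂ λ j s → j < m × s < f j × r ≡ sumTo f j + s
sumTo-locate f (suc m) {r} r< with r <? sumTo f m
... | yes r<m = let j , s , j<m , rest = sumTo-locate f m r<m in j , s , m<n⇒m<1+n j<m , rest
... | no  r≮m = m , r ∸ sumTo f m , ≤-refl ,
  +-cancelˡ-< (sumTo f m) _ _ (subst (_< sumTo f m + f m) (sym r≡) r<) , sym r≡
  where
  r≡ : sumTo f m + (r ∸ sumTo f m) ≡ r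
  r≡ = m+[n∸m]≡n (≮⇒≥ r≮m)

indicator : ∀ {P : Set} → Dec P → ℕ
indicator (yes _) = 1
indicator (no  _) = 0

indicator-yes : ∀ {P : Set} (d : Dec P) → P → indicator d ≡ 1
indicator-yes (yes _) _ = refl
indicator-yes (no ¬p) p = contradiction p ¬p

indicator-mono : ∀ {P Q : Set} (d : Dec P) (e : Dec Q) → (P → Q) → indicator d ≤ indicator e
indicator-mono (yes p) e f = ≤-reflexive (sym (indicator-yes e (f p)))
indicator-mono (no _)  e f = z≤n

indicator-cong : ∀ {P Q : Set} (d : Dec P) (e : Dec Q) → (P → Q) → (Q → P) → indicator d ≡ indicator e
indicator-cong d e f g = ≤-antisym (indicator-mono d e f) (indicator-mono e d g)

sum-mono : ∀ {m} {f g : Fin m → ℕ} → (∀ x → f x ≤ g x) → sum f ≤ sum g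
sum-mono {zero}  h = z≤n
sum-mono {suc m} h = +-mono-≤ (h Fin.zero) (sum-mono (h ∘ Fin.suc))

sum-mono-< : ∀ {m} {f g : Fin m → ℕ} → (∀ x → f x ≤ g x) → ∀ x → f x < g x → sum f < sum g
sum-mono-< h Fin.zero    lt = +-mono-<-≤ lt (sum-mono (h ∘ Fin.suc))
sum-mono-< h (Fin.suc x) lt = +-mono-≤-< (h Fin.zero) (sum-mono-< (h ∘ Fin.suc) x lt)

sum-ones : ∀ m → sum {m} (λ _ → 1) ≡ m
sum-ones zero    = refl
sum-ones (suc m) = cong suc (sum-ones m)

sum-zeros : ∀ {m} {f : Fin m → ℕ} → (∀ x → f x ≡ 0) → sum f ≡ 0
sum-zeros {m} h = trans (sum-cong-≗ h) (sum-replicate-zero m)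

sum-hits : ∀ {m} (x : Fin m) → ∑[ y < m ] indicator (x Fin.≟ y) ≡ 1
sum-hits {suc m} Fin.zero    = cong suc (sum-zeros {m} (λ _ → refl))
sum-hits {suc m} (Fin.suc x) = trans
  (sum-cong-≗ (λ y → indicator-cong (Fin.suc x Fin.≟ Fin.suc y) (x Fin.≟ y) Fin.suc-injective (cong Fin.suc)))
  (sum-hits x)

-- Double counting: every `x` hits one `y`, and a `y` is hit at most once, and only if it satisfies
-- `P`.
injective-count : ∀ {a m} {P : Fin m → Set} (P? : ∀ y → Dec (P y)) (g : Fin a → Fin m) →
                  Injective _≡_ _≡_ g → (∀ x → P (g x)) → a ≤ ∑[ y < m ] indicator (P? y)
injective-count {a} {m} P? g inj Pg = begin
  a                                                     ≡⟨ sum-ones a ⟨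
  ∑[ x < a ] 1                                          ≡⟨ sum-cong-≗ (λ x → sum-hits (g x)) ⟨
  ∑[ x < a ] ∑[ y < m ] indicator (g x Fin.≟ y)         ≡⟨ ∑-comm (λ x y → indicator (g x Fin.≟ y)) ⟩
  ∑[ y < m ] ∑[ x < a ] indicator (g x Fin.≟ y)         ≤⟨ sum-mono (λ y → fibre y (P? y)) ⟩
  ∑[ y < m ] indicator (P? y)                           ∎
  where
  open ≤-Reasoning
  atMostOne : ∀ {b} (h : Fin b → Fin m) → Injective _≡_ _≡_ h → ∀ y → ∑[ x < b ] indicator (h x Fin.≟ y) ≤ 1
  atMostOne {zero}  h inj y = z≤n
  atMostOne {suc b} h inj y with h Fin.zero Fin.≟ y
  ... | no  _    = atMostOne (h ∘ Fin.suc) (Fin.suc-injective ∘ inj) y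
  ... | yes refl = ≤-reflexive (cong suc (sum-zeros
    (λ x → ≤-antisym (indicator-mono (h (Fin.suc x) Fin.≟ h Fin.zero) (no (λ ()))
                                     (λ eq → Fin.0≢1+n (sym (inj eq)))) z≤n)))
  fibre : ∀ y (d : Dec _) → ∑[ x < a ] indicator (g x Fin.≟ y) ≤ indicator d
  fibre y (yes _)  = atMostOne g inj y
  fibre y (no ¬Py) = ≤-reflexive (sum-zeros (λ x → ≤-antisym
    (indicator-mono (g x Fin.≟ y) (no (λ ())) (λ eq → ¬Py (subst _ eq (Pg x)))) z≤n))

sumTo-sum : ∀ {m} (g : ℕ → Fin m → ℕ) b → sumTo (λ j → sum (g j)) b ≡ ∑[ p < m ] sumTo (λ j → g j p) b
sumTo-sum {m} g zero    = sym (sum-replicate-zero m)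
sumTo-sum g (suc b) = trans (cong (_+ sum (g b)) (sumTo-sum g b))
                            (sym (∑-distrib-+ (λ p → sumTo (λ j → g j p) b) (g b)))

sumTo-hits : ∀ {P : Set} (d : Dec P) {x m} → x < m → sumTo (λ j → indicator (d ×-dec (x ≟ j))) m ≡ indicator d
sumTo-hits {P} d {x} {suc m} x<1+m with x ≟ m
... | yes refl = cong₂ _+_ (miss m ≤-refl)
                           (indicator-cong (d ×-dec yes refl) d proj₁ (_, refl))
  where
  miss : ∀ b → b ≤ x → sumTo (λ j → indicator (d ×-dec (x ≟ j))) b ≡ 0
  miss zero    _   = refl
  miss (suc b) b<x = cong₂ _+_ (miss b (<⇒≤ b<x))
    (≤-antisym (indicator-mono (d ×-dec (x ≟ b)) (no (λ ())) (λ e → <⇒≢ b<x (sym (proj₂ e)))) z≤n)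
... | no x≢m = trans (cong₂ _+_ (sumTo-hits d (≤∧≢⇒< (≤-pred x<1+m) x≢m))
    (≤-antisym (indicator-mono (d ×-dec no x≢m) (no (λ ())) (λ e → x≢m (proj₂ e))) z≤n)) (+-identityʳ _)

-- Increasing subsequences as chains of positions.

lookup-AllPairs : ∀ {X : Set} {R : Rel X 0ℓ} {xs} → AllPairs R xs →
                  ∀ {a b} → a Fin.< b → R (lookup xs a) (lookup xs b)
lookup-AllPairs (h ∷ _)  {Fin.zero}  {Fin.suc b} _         = All.lookup h (∈-lookup b)
lookup-AllPairs (_ ∷ hs) {Fin.suc a} {Fin.suc b} (s≤s a<b) = lookup-AllPairs hs a<b

-- Positions are totally ordered, so preserving the order implies reflecting it.
increasing⇒contains : ∀ {N c} (w : Permutation′ N) (f : Fin c → Fin N) →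
                      (∀ {a b} → a Fin.< b → f a Fin.< f b) →
                      (∀ {a b} → a Fin.< b → (w ⟨$⟩ʳ f a) Fin.< (w ⟨$⟩ʳ f b)) →
                      Contains w (incr c)
increasing⇒contains w f mono w-mono = f , (λ a b → mono) , (λ a b → reflect a b , w-mono)
  where
  reflect : ∀ a b → (w ⟨$⟩ʳ f a) Fin.< (w ⟨$⟩ʳ f b) → a Fin.< b
  reflect a b lt with Fin.<-cmp a b
  ... | tri< a<b _ _  = a<b
  ... | tri≈ _ refl _ = contradiction lt (<-irrefl refl)
  ... | tri> _ _ b<a  = contradiction lt (<-asym (w-mono b<a))

chain⇒contains : ∀ {N} (w : Permutation′ N) {xs} →
                 AllPairs (λ p q → p Fin.< q × (w ⟨$⟩ʳ p) Fin.< (w ⟨$⟩ʳ q)) xs →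
                 ∀ {c} → c ≤ length xs → Contains w (incr c)
chain⇒contains w {xs} chain c≤ = increasing⇒contains w (λ a → lookup xs (Fin.inject≤ a c≤))
  (λ {a} {b} a<b → proj₁ (lookup-AllPairs chain (injected a b a<b)))
  (λ {a} {b} a<b → proj₂ (lookup-AllPairs chain (injected a b a<b)))
  where
  injected : ∀ a b → a Fin.< b → Fin.inject≤ a c≤ Fin.< Fin.inject≤ b c≤
  injected a b = subst₂ _<_ (sym (Fin.toℕ-inject≤ a c≤)) (sym (Fin.toℕ-inject≤ b c≤))

contains-cong : ∀ {N c} (v w : Permutation′ N) → (∀ p → v ⟨$⟩ʳ p ≡ w ⟨$⟩ʳ p) →
                Contains v (incr c) → Contains w (incr c)
contains-cong v w eq (f , mono , iso) = increasing⇒contains w f (mono _ _)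
  (λ {a} {b} a<b → subst₂ Fin._<_ (eq (f a)) (eq (f b)) (proj₂ (iso a b) a<b))

-- The values of an increasing subsequence of the inverse are the positions of one in `w`.
contains-flip : ∀ {N c} (w : Permutation′ N) → Contains (flip w) (incr c) → Contains w (incr c)
contains-flip w (f , mono , iso) = increasing⇒contains w (λ a → w ⟨$⟩ˡ f a)
  (λ {a} {b} → proj₂ (iso a b))
  (λ {a} {b} a<b → subst₂ Fin._<_ (sym (inverseʳ w)) (sym (inverseʳ w)) (mono a b a<b))

increasing-≥ : ∀ {c} (g : Fin c → ℕ) → (∀ {a b} → a Fin.< b → g a < g b) → ∀ a → toℕ a ≤ g a
increasing-≥ g mono Fin.zero    = z≤n
increasing-≥ g mono (Fin.suc a) = ≤-trans (s≤s (increasing-≥ (g ∘ Fin.inject₁) mono′ a))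
  (mono (s≤s (≤-reflexive (Fin.toℕ-inject₁ a))))
  where
  mono′ : ∀ {a b} → a Fin.< b → g (Fin.inject₁ a) < g (Fin.inject₁ b)
  mono′ {a} {b} a<b = mono (subst₂ _<_ (sym (Fin.toℕ-inject₁ a)) (sym (Fin.toℕ-inject₁ b)) a<b)

-- Standardisation of a matrix

-- `N` is a separate parameter because the case `m = 0` is applied with `N = n`, which is not
-- definitionally `n * 1`.
module Standard (n m N : ℕ) (N≡ : N ≡ n * suc m) where

  private
    k : ℕ
    k = suc m

  block : Fin N → ℕ
  block p = toℕ p / k

  block-lex : ∀ {i i' x x'} → x < k → i < i' → k * i + x < k * i' + x'
  block-lex {i} {i'} {x} {x'} x<k i<i' = begin-strict
    k * i + x   <⟨ +-monoʳ-< (k * i) x<k ⟩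
    k * i + k   ≡⟨ trans (+-comm (k * i) k) (sym (*-suc k i)) ⟩
    k * suc i   ≤⟨ *-monoʳ-≤ k i<i' ⟩
    k * i'      ≤⟨ m≤m+n _ x' ⟩
    k * i' + x' ∎
    where open ≤-Reasoning

  position< : ∀ {i x} → i < n → x < k → k * i + x < N
  position< {i} {x} i<n x<k = begin-strict
    k * i + x   <⟨ block-lex {x' = 0} x<k i<n ⟩
    k * n + 0   ≡⟨ trans (+-identityʳ _) (*-comm k n) ⟩
    n * k       ≡⟨ N≡ ⟨
    N           ∎
    where open ≤-Reasoning

  block-offset : ∀ p → toℕ p ≡ k * block p + toℕ p % k
  block-offset p = trans (m≡m%n+[m/n]*n (toℕ p) k)
    (trans (+-comm (toℕ p % k) _) (cong (_+ toℕ p % k) (*-comm (block p) k)))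

  block<n : ∀ p → block p < n
  block<n p = m<n*o⇒m/o<n (subst (toℕ p <_) N≡ (toℕ<n p))

  block-mono : ∀ {p q} → p Fin.≤ q → block p ≤ block q
  block-mono p≤q = /-monoˡ-≤ k p≤q

  block-unique : ∀ {p i x} → x < k → toℕ p ≡ k * i + x → block p ≡ i
  block-unique {p} {i} {x} x<k p≡ with <-cmp (block p) i
  ... | tri≈ _ eq _ = eq
  ... | tri< lt _ _ = contradiction (trans (sym (block-offset p)) p≡) (<⇒≢ (block-lex (m%n<n (toℕ p) k) lt))
  ... | tri> _ _ gt = contradiction (trans (sym p≡) (block-offset p)) (<⇒≢ (block-lex x<k gt))

  Increasing : Permutation′ N → Set
  Increasing w = ∀ {p q} → block p ≡ block q → p Fin.< q → (w ⟨$⟩ʳ p) Fin.< (w ⟨$⟩ʳ q)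

  inCell? : ∀ w i j p → Dec (block p ≡ i × block (w ⟨$⟩ʳ p) ≡ j)
  inCell? w i j p = (block p ≟ i) ×-dec (block (w ⟨$⟩ʳ p) ≟ j)

  count : Permutation′ N → Matrix
  count w i j = ∑[ p < N ] indicator (inCell? w i j p)

  count-flip : ∀ w i j → count (flip w) j i ≡ count w i j
  count-flip w i j = trans
    (∑-permute (λ q → indicator (inCell? (flip w) j i q)) w)
    (sum-cong-≗ (λ p → indicator-cong (inCell? (flip w) j i (w ⟨$⟩ʳ p)) (inCell? w i j p)
      (λ (e , e') → trans (cong block (sym (inverseˡ w))) e' , e)
      (λ (e , e') → e' , trans (cong block (inverseˡ w)) e)))

  -- Each block holds at least `k` positions by an explicit injection, and the `n` blocks share
  -- `n * k` positions.
  count-block : ∀ {i} → i < n → ∑[ p < N ] indicator (block p ≟ i) ≡ k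
  count-block i<n = sym (sumTo-squeeze n atLeast (≤-reflexive total) i<n)
    where
    atLeast : ∀ {i} → i < n → k ≤ ∑[ p < N ] indicator (block p ≟ i)
    atLeast {i} i<n = injective-count (λ p → block p ≟ i)
      (λ r → fromℕ< (position< i<n (toℕ<n r)))
      (λ {r} {r'} eq → toℕ-injective (+-cancelˡ-≡ (k * i) _ _
         (trans (sym (toℕ-fromℕ< _)) (trans (cong toℕ eq) (toℕ-fromℕ< _)))))
      (λ r → block-unique (toℕ<n r) (toℕ-fromℕ< _))
    total : sumTo (λ i → ∑[ p < N ] indicator (block p ≟ i)) n ≡ sumTo (λ _ → k) n
    total = begin
      sumTo (λ i → ∑[ p < N ] indicator (block p ≟ i)) n
        ≡⟨ sumTo-sum (λ i p → indicator (block p ≟ i)) n ⟩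
      ∑[ p < N ] sumTo (λ i → indicator (block p ≟ i)) n
        ≡⟨ sum-cong-≗ (λ p → trans
             (sumTo-cong n (λ {i} _ → indicator-cong (block p ≟ i) (yes refl ×-dec (block p ≟ i)) (refl ,_) proj₂))
             (sumTo-hits {0 ≡ 0} (yes refl) (block<n p))) ⟩
      ∑[ p < N ] 1         ≡⟨ sum-ones N ⟩
      N                    ≡⟨ N≡ ⟩
      n * k                ≡⟨ sumTo-const k n ⟨
      sumTo (λ _ → k) n    ∎
      where open ≡-Reasoning

  count-rowSum : ∀ w {i} → i < n → sumTo (count w i) n ≡ k
  count-rowSum w {i} i<n = begin
    sumTo (count w i) n
      ≡⟨ sumTo-sum (λ j p → indicator (inCell? w i j p)) n ⟩
    ∑[ p < N ] sumTo (λ j → indicator (inCell? w i j p)) n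
      ≡⟨ sum-cong-≗ (λ p → sumTo-hits (block p ≟ i) (block<n (w ⟨$⟩ʳ p))) ⟩
    ∑[ p < N ] indicator (block p ≟ i)
      ≡⟨ count-block i<n ⟩
    k ∎
    where open ≡-Reasoning

  count-colSum : ∀ w {j} → j < n → sumTo (transpose (count w) j) n ≡ k
  count-colSum w {j} j<n =
    trans (sumTo-cong n (λ {i} _ → sym (count-flip w i j))) (count-rowSum (flip w) j<n)

  Doubly : Permutation′ N → Set
  Doubly w = Increasing w × Increasing (flip w)

  -- At the least position where v and w differ, the smaller of the two values
  -- makes its cell count strictly larger.
  count-drop : ∀ v w → Doubly w → ∀ p → (∀ q → q Fin.< p → v ⟨$⟩ʳ q ≡ w ⟨$⟩ʳ q) →
               (v ⟨$⟩ʳ p) Fin.< (w ⟨$⟩ʳ p) →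
               count w (block p) (block (v ⟨$⟩ʳ p)) < count v (block p) (block (v ⟨$⟩ʳ p))
  count-drop v w (inc , inc⁻¹) p agree lt = sum-mono-<
    (λ q → indicator-mono (inCell? w (block p) j q) (inCell? v (block p) j q)
      (λ (e , e') → e , trans (cong block (agree q (before q e e'))) e'))
    p
    (≤-trans (s≤s (indicator-mono (inCell? w (block p) j p) (no (λ ())) (λ (_ , e) → different e)))
             (≤-reflexive (sym (indicator-yes (inCell? v (block p) j p) (refl , refl)))))
    where
    j : ℕ
    j = block (v ⟨$⟩ʳ p)
    -- Otherwise `w` would take the value of `v` at `p` somewhere left of `p`, as `flip w` increases
    -- on that block; there `v` agrees with `w`, so `v` would repeat a value.
    different : ¬ block (w ⟨$⟩ʳ p) ≡ j
    different e = Fin.<⇒≢ p'<p (v-injective (trans (agree p' p'<p) (inverseʳ w)))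
      where
      p' : Fin N
      p' = w ⟨$⟩ˡ (v ⟨$⟩ʳ p)
      p'<p : p' Fin.< p
      p'<p = subst (p' Fin.<_) (inverseˡ w) (inc⁻¹ (sym e) lt)
      v-injective : ∀ {x y} → v ⟨$⟩ʳ x ≡ v ⟨$⟩ʳ y → x ≡ y
      v-injective eq = trans (sym (inverseˡ v)) (trans (cong (v ⟨$⟩ˡ_) eq) (inverseˡ v))
    -- A point of `w` in this cell right of `p` would put the value of `w` at `p` between two values
    -- of block `j`, hence in that block.
    before : ∀ q → block q ≡ block p → block (w ⟨$⟩ʳ q) ≡ j → q Fin.< p
    before q e e' with Fin.<-cmp q p
    ... | tri< q<p _ _  = q<p
    ... | tri≈ _ refl _ = contradiction e' different
    ... | tri> _ _ p<q  = contradiction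
      (≤-antisym (≤-trans (block-mono (<⇒≤ (inc (sym e) p<q))) (≤-reflexive e')) (block-mono (<⇒≤ lt)))
      different

  -- At the first disagreement `count-drop` separates the counts, whichever permutation has the
  -- smaller value there.
  count-injective : ∀ {v w} → Doubly v → Doubly w → Agree n (count v) (count w) →
                    ∀ p → v ⟨$⟩ʳ p ≡ w ⟨$⟩ʳ p
  count-injective {v} {w} dv dw same p = go p (<-wellFounded (toℕ p))
    where
    go : ∀ p → Acc _<_ (toℕ p) → v ⟨$⟩ʳ p ≡ w ⟨$⟩ʳ p
    go p (acc rec) with Fin.<-cmp (v ⟨$⟩ʳ p) (w ⟨$⟩ʳ p)
    ... | tri≈ _ eq _ = eq
    ... | tri< lt _ _ = contradiction (sym (same (block<n p) (block<n (v ⟨$⟩ʳ p))))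
      (<⇒≢ (count-drop v w dw p (λ q q<p → go q (rec q<p)) lt))
    ... | tri> _ _ gt = contradiction (same (block<n p) (block<n (w ⟨$⟩ʳ p)))
      (<⇒≢ (count-drop w v dv p (λ q q<p → sym (go q (rec q<p))) gt))

  LineSums : Matrix → Set
  LineSums A = (∀ {i} → i < n → sumTo (A i) n ≡ k) × (∀ {j} → j < n → sumTo (transpose A j) n ≡ k)

  -- Coordinates of a position when each row block lists the points of its cells from left to right,
  -- `A row col` points per cell.
  record Cell (A : Matrix) (p : Fin N) : Set where
    constructor cell
    field
      row col idx : ℕ
      row< : row < n
      col< : col < n
      idx< : idx < A row col
      place≡ : toℕ p ≡ k * row + (sumTo (A row) col + idx)

  open Cell

  module _ {A : Matrix} (rowSum : ∀ {i} → i < n → sumTo (A i) n ≡ k) where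

    offset< : ∀ {i j s} → i < n → j < n → s < A i j → sumTo (A i) j + s < k
    offset< {i} {j} {s} i<n j<n s< = subst (sumTo (A i) j + s <_) (trans (+-identityʳ _) (rowSum i<n))
      (sumTo-lex (A i) {s' = 0} s< j<n)

    place : ∀ {i j s} → i < n → j < n → s < A i j → Fin N
    place i<n j<n s< = fromℕ< (position< i<n (offset< i<n j<n s<))

    placeCell : ∀ {i j s} (i<n : i < n) (j<n : j < n) (s< : s < A i j) → Cell A (place i<n j<n s<)
    placeCell i<n j<n s< = cell _ _ _ i<n j<n s< (toℕ-fromℕ< _)

    locate : ∀ p → Cell A p
    locate p = let j , s , j<n , s< , eq = sumTo-locate (A (block p)) n
                         (subst (toℕ p % k <_) (sym (rowSum (block<n p))) (m%n<n (toℕ p) k))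
               in cell (block p) j s (block<n p) j<n s<
                       (trans (block-offset p) (cong (k * block p +_) eq))

    block≡row : ∀ {p} (c : Cell A p) → block p ≡ row c
    block≡row c = block-unique (offset< (row< c) (col< c) (idx< c)) (place≡ c)

    Lex : ∀ {p q} → Cell A p → Cell A q → Set
    Lex c d = row c < row d ⊎ row c ≡ row d × (col c < col d ⊎ col c ≡ col d × idx c < idx d)

    lex⇒< : ∀ {p q} (c : Cell A p) (d : Cell A q) → Lex c d → p Fin.< q
    lex⇒< c d h = subst₂ _<_ (sym (place≡ c)) (sym (place≡ d)) (go c d h)
      where
      go : ∀ {p q} (c : Cell A p) (d : Cell A q) → Lex c d →
           k * row c + (sumTo (A (row c)) (col c) + idx c) < k * row d + (sumTo (A (row d)) (col d) + idx d)
      go c d (inj₁ h) = block-lex (offset< (row< c) (col< c) (idx< c)) h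
      go c (cell _ _ _ _ _ _ _) (inj₂ (refl , inj₁ h)) =
        +-monoʳ-< (k * row c) (sumTo-lex (A (row c)) (idx< c) h)
      go c (cell _ _ _ _ _ _ _) (inj₂ (refl , inj₂ (refl , h))) =
        +-monoʳ-< (k * row c) (+-monoʳ-< (sumTo (A (row c)) (col c)) h)

    SameIndex : ∀ {p q} → Cell A p → Cell A q → Set
    SameIndex c d = row c ≡ row d × col c ≡ col d × idx c ≡ idx d

    lex-compare : ∀ {p q} (c : Cell A p) (d : Cell A q) → Lex c d ⊎ SameIndex c d ⊎ Lex d c
    lex-compare c d with <-cmp (row c) (row d)
    ... | tri< lt _ _ = inj₁ (inj₁ lt)
    ... | tri> _ _ gt = inj₂ (inj₂ (inj₁ gt))
    ... | tri≈ _ r _ with <-cmp (col c) (col d)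
    ...   | tri< lt _ _ = inj₁ (inj₂ (r , inj₁ lt))
    ...   | tri> _ _ gt = inj₂ (inj₂ (inj₂ (sym r , inj₁ gt)))
    ...   | tri≈ _ s _ with <-cmp (idx c) (idx d)
    ...     | tri< lt _ _ = inj₁ (inj₂ (r , inj₂ (s , lt)))
    ...     | tri> _ _ gt = inj₂ (inj₂ (inj₂ (sym r , inj₂ (sym s , gt))))
    ...     | tri≈ _ t _ = inj₂ (inj₁ (r , s , t))

    sameIndex⇒≡ : ∀ {p q} (c : Cell A p) (d : Cell A q) → SameIndex c d → p ≡ q
    sameIndex⇒≡ c (cell _ _ _ _ _ _ eq) (refl , refl , refl) = toℕ-injective (trans (place≡ c) (sym eq))

    <⇒lex : ∀ {p q} (c : Cell A p) (d : Cell A q) → p Fin.< q → Lex c d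
    <⇒lex c d p<q with lex-compare c d
    ... | inj₁ lt        = lt
    ... | inj₂ (inj₁ eq) = contradiction (cong toℕ (sameIndex⇒≡ c d eq)) (<⇒≢ p<q)
    ... | inj₂ (inj₂ gt) = contradiction p<q (<-asym (lex⇒< d c gt))

    cell-unique : ∀ {p q} (c : Cell A p) (d : Cell A q) → p ≡ q → SameIndex c d
    cell-unique c d p≡q with lex-compare c d
    ... | inj₁ lt        = contradiction (cong toℕ p≡q) (<⇒≢ (lex⇒< c d lt))
    ... | inj₂ (inj₁ eq) = eq
    ... | inj₂ (inj₂ gt) = contradiction (cong toℕ (sym p≡q)) (<⇒≢ (lex⇒< d c gt))

  -- The point numbered `idx` in its cell takes the value numbered `idx` for that cell in the
  -- column-wise listing, which is the row-wise listing of the transpose.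
  transport : ∀ A → LineSums A → Fin N → Fin N
  transport A (R , C) p = let c = locate R p in place {transpose A} C (col< c) (row< c) (idx< c)

  transportCell : ∀ A (L : LineSums A) {p} → Cell A p → Cell (transpose A) (transport A L p)
  transportCell A L@(R , C) {p} c =
    cell (col c) (row c) (idx c) (col< c) (row< c) (idx< c) (index≡ c (cell-unique R c (locate R p) refl))
    where
    index≡ : (c : Cell A p) → SameIndex R c (locate R p) →
             toℕ (transport A L p) ≡ k * col c + (sumTo (transpose A (col c)) (row c) + idx c)
    index≡ c (refl , refl , refl) = toℕ-fromℕ< _

  transport-inverse : ∀ A (L : LineSums A) p → transport (transpose A) (swap L) (transport A L p) ≡ p
  transport-inverse A L@(R , C) p =
    sameIndex⇒≡ R (transportCell (transpose A) (swap L) (transportCell A L c)) c (refl , refl , refl)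
    where
    c : Cell A p
    c = locate R p

  standard : ∀ A → LineSums A → Permutation′ N
  standard A L = permutation (transport A L) (transport (transpose A) (swap L))
    (transport-inverse (transpose A) (swap L)) (transport-inverse A L)

  -- Inside a row block, positions are ordered by column and then index, and the values follow the
  -- same order.
  transport-increasing : ∀ A (L : LineSums A) {p q} → block p ≡ block q → p Fin.< q →
                         transport A L p Fin.< transport A L q
  transport-increasing A L@(R , C) {p} {q} same p<q =
    lex⇒< C (transportCell A L c) (transportCell A L d) (swapped (<⇒lex R c d p<q))
    where
    c : Cell A p
    c = locate R p
    d : Cell A q
    d = locate R q
    swapped : Lex R c d → Lex C (transportCell A L c) (transportCell A L d)
    swapped (inj₁ lt)                  = contradiction same (<⇒≢ lt)
    swapped (inj₂ (r , inj₁ lt))       = inj₁ lt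
    swapped (inj₂ (r , inj₂ (s , lt))) = inj₂ (s , inj₂ (r , lt))

  standard-doubly : ∀ A L → Doubly (standard A L)
  standard-doubly A L = transport-increasing A L , transport-increasing (transpose A) (swap L)

  -- The places of each cell bound its count from below, and the row sums of both matrices are `k`.
  count-standard : ∀ A L → Agree n (count (standard A L)) A
  count-standard A L@(R , C) {i} {j} i<n j<n = sym (sumTo-squeeze n atLeast
    (≤-reflexive (trans (count-rowSum (standard A L) i<n) (sym (R i<n)))) j<n)
    where
    atLeast : ∀ {j} → j < n → A i j ≤ count (standard A L) i j
    atLeast {j} j<n = injective-count (inCell? (standard A L) i j)
      (λ s → place R i<n j<n (toℕ<n s))
      (λ {s} {t} eq → toℕ-injective (proj₂ (proj₂ (cell-unique R (pc s) (pc t) eq))))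
      (λ s → block≡row R (pc s) , block≡row C (transportCell A L (pc s)))
      where
      pc : ∀ s → Cell A (place R i<n j<n (toℕ<n s))
      pc s = placeCell R i<n j<n (toℕ<n s)

  standard-count : ∀ A L w → Doubly w → Agree n A (count w) → ∀ p → standard A L ⟨$⟩ʳ p ≡ w ⟨$⟩ʳ p
  standard-count A L w dw eq = count-injective {standard A L} {w} (standard-doubly A L) dw
    (λ i<n j<n → trans (count-standard A L i<n j<n) (eq i<n j<n))

  module _ (A : Matrix) (L : LineSums A) where

    private
      w : Permutation′ N
      w = standard A L
      R = proj₁ L
      C = proj₂ L

    -- The number of points that come before the given one on a heaviest south-east path ending at
    -- its cell.
    level : ∀ {p} → Cell A p → ℕ
    level c = (Λ A (row c) (suc (col c)) 0 ⊔ Λ A (suc (row c)) (col c) 0) + idx c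

    level<Λ : ∀ {p} (c : Cell A p) → level c < Λ A (suc (row c)) (suc (col c)) 0
    level<Λ c = +-monoʳ-< (Λ A (row c) (suc (col c)) 0 ⊔ _) (idx< c)

    -- A later point with a larger value lies either in another cell weakly to the south-east, where
    -- `Λ-mono` applies, or in the same cell with a larger index.
    level-mono : ∀ {p q} (c : Cell A p) (d : Cell A q) → p Fin.< q →
                 (w ⟨$⟩ʳ p) Fin.< (w ⟨$⟩ʳ q) → level c < level d
    level-mono c d p<q wp<wq =
      go d (<⇒lex R c d p<q) (<⇒lex C (transportCell A L c) (transportCell A L d) wp<wq)
      where
      north : ∀ {q} (d : Cell A q) → row c < row d → col c ≤ col d → level c < level d
      north d r s = <-≤-trans (level<Λ c)
        (≤-trans (Λ-mono A 0 r (s≤s s)) (≤-trans (m≤m⊔n _ _) (m≤m+n _ (idx d))))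
      west : ∀ {q} (d : Cell A q) → row c ≤ row d → col c < col d → level c < level d
      west d r s = <-≤-trans (level<Λ c)
        (≤-trans (Λ-mono A 0 (s≤s r) s) (≤-trans (m≤n⊔m (Λ A (row d) (suc (col d)) 0) _) (m≤m+n _ (idx d))))
      go : ∀ {q} (d : Cell A q) → Lex R c d → Lex C (transportCell A L c) (transportCell A L d) →
           level c < level d
      go d (inj₁ r)              (inj₁ s)       = north d r (<⇒≤ s)
      go d (inj₁ r)              (inj₂ (s , _)) = north d r (≤-reflexive s)
      go d (inj₂ (r , inj₁ s))   _              = west d (≤-reflexive r) s
      go (cell _ _ _ _ _ _ _) (inj₂ (refl , inj₂ (refl , t))) _ = +-monoʳ-< (Λ A (row c) (suc (col c)) 0 ⊔ _) t

    -- Levels increase strictly along an increasing subsequence, so the last is at least the length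
    -- minus one, and it is below `Λ A n n 0`.
    contains⇒≤Λ : ∀ {c} → Contains w (incr c) → c ≤ Λ A n n 0
    contains⇒≤Λ {zero}  _ = z≤n
    contains⇒≤Λ {suc c} (f , mono , iso) = begin-strict
      c                          ≡⟨ Fin.toℕ-fromℕ c ⟨
      toℕ (Fin.fromℕ c)          ≤⟨ increasing-≥ (λ a → level (at a))
                                      (λ {a} {b} a<b → level-mono (at a) (at b) (mono a b a<b)
                                                                  (proj₂ (iso a b) a<b))
                                      (Fin.fromℕ c) ⟩
      level last                 <⟨ level<Λ last ⟩
      Λ A (suc (row last)) (suc (col last)) 0 ≤⟨ Λ-mono A 0 (row< last) (col< last) ⟩
      Λ A n n 0                  ∎
      where
      open ≤-Reasoning
      at : ∀ a → Cell A (f a)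
      at a = locate R (f a)
      last : Cell A (f (Fin.fromℕ c))
      last = at (Fin.fromℕ c)

    _↗_ : Rel (Fin N) 0ℓ
    p ↗ q = p Fin.< q × (w ⟨$⟩ʳ p) Fin.< (w ⟨$⟩ʳ q)

    Within : ℕ → ℕ → Fin N → Set
    Within i j p = block p < i × block (w ⟨$⟩ʳ p) < j

    Chain : ℕ → ℕ → Set
    Chain i j = ∃ λ xs → length xs ≡ Λ A i j 0 × AllPairs _↗_ xs × All (Within i j) xs

    module _ {i j : ℕ} (i<n : i < n) (j<n : j < n) where

      fill : List (Fin N)
      fill = tabulate (λ s → place R {i} {j} i<n j<n (toℕ<n s))

      private
        at : ∀ s → Cell A (place R {i} {j} i<n j<n (toℕ<n s))
        at s = placeCell R i<n j<n (toℕ<n s)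

      fill-↗ : AllPairs _↗_ fill
      fill-↗ = AllPairs.tabulate⁺-< (λ {s} {t} s<t →
        lex⇒< R (at s) (at t) (inj₂ (refl , inj₂ (refl , s<t))) ,
        lex⇒< C (transportCell A L (at s)) (transportCell A L (at t)) (inj₂ (refl , inj₂ (refl , s<t))))

      -- All points of the old chain precede those of the new cell in position and in value; the sum
      -- type tells whether they come from the northern or the western neighbour.
      append : ∀ {i' j'} → (i' ≤ i × j' ≤ suc j) ⊎ (i' ≤ suc i × j' ≤ j) →
               ∀ {xs} → AllPairs _↗_ xs → All (Within i' j') xs →
               AllPairs _↗_ (xs ++ fill) × All (Within (suc i) (suc j)) (xs ++ fill)
      append {i'} {j'} side {xs} chain within =
        AllPairs.++⁺ chain fill-↗ (All.map (λ h → All.tabulate⁺ (λ s → before side h s)) within) ,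
        All.++⁺ (All.map (enlarge side) within)
                (All.tabulate⁺ (λ s → s≤s (≤-reflexive (block≡row R (at s))) ,
                                      s≤s (≤-reflexive (block≡row C (transportCell A L (at s))))))
        where
        enlarge : (i' ≤ i × j' ≤ suc j) ⊎ (i' ≤ suc i × j' ≤ j) →
                  ∀ {p} → Within i' j' p → Within (suc i) (suc j) p
        enlarge (inj₁ (a , b)) (x , y) = <-≤-trans x (m≤n⇒m≤1+n a) , <-≤-trans y b
        enlarge (inj₂ (a , b)) (x , y) = <-≤-trans x a , <-≤-trans y (m≤n⇒m≤1+n b)
        before : (i' ≤ i × j' ≤ suc j) ⊎ (i' ≤ suc i × j' ≤ j) → ∀ {p} → Within i' j' p →
                 ∀ s → p ↗ place R i<n j<n (toℕ<n s)
        before side {p} (x , y) s = lex⇒< R c (at s) (proj₁ (lexes side r< s<)) ,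
                                    lex⇒< C (transportCell A L c) (transportCell A L (at s))
                                          (proj₂ (lexes side r< s<))
          where
          c : Cell A p
          c = locate R p
          r< : row c < i'
          r< = subst (_< i') (block≡row R c) x
          s< : col c < j'
          s< = subst (_< j') (block≡row C (transportCell A L c)) y
          lexes : (i' ≤ i × j' ≤ suc j) ⊎ (i' ≤ suc i × j' ≤ j) → row c < i' → col c < j' →
                  Lex R c (at s) × Lex C (transportCell A L c) (transportCell A L (at s))
          -- A point from the north may share column `j`; its smaller row then decides the order of
          -- the values.
          lexes (inj₁ (a , b)) r t with m≤n⇒m<n∨m≡n (≤-pred (<-≤-trans t b))
          ... | inj₁ lt = inj₁ (<-≤-trans r a) , inj₁ lt
          ... | inj₂ eq = inj₁ (<-≤-trans r a) , inj₂ (eq , inj₁ (<-≤-trans r a))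
          lexes (inj₂ (a , b)) r t with m≤n⇒m<n∨m≡n (≤-pred (<-≤-trans r a))
          ... | inj₁ lt = inj₁ lt , inj₁ (<-≤-trans t b)
          ... | inj₂ eq = inj₂ (eq , inj₁ (<-≤-trans t b)) , inj₁ (<-≤-trans t b)

    -- Traces a heaviest path back through the neighbour attaining the maximum and takes all points
    -- of the cells on it.
    longest : ∀ i j → i ≤ n → j ≤ n → Chain i j
    longest zero    j       _   _   = [] , refl , [] , []
    longest (suc i) zero    _   _   = [] , refl , [] , []
    longest (suc i) (suc j) i<n j<n with ⊔-sel (Λ A i (suc j) 0) (Λ A (suc i) j 0)
    ... | inj₁ eq =
      let xs , len , chain , within = longest i (suc j) (<⇒≤ i<n) j<n in
      xs ++ fill i<n j<n ,
      trans (length-++ xs) (cong₂ _+_ (trans len (sym eq)) (length-tabulate _)) ,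
      append i<n j<n (inj₁ (≤-refl , ≤-refl)) chain within
    ... | inj₂ eq =
      let xs , len , chain , within = longest (suc i) j i<n (<⇒≤ j<n) in
      xs ++ fill i<n j<n ,
      trans (length-++ xs) (cong₂ _+_ (trans len (sym eq)) (length-tabulate _)) ,
      append i<n j<n (inj₂ (≤-refl , ≤-refl)) chain within

    ≤Λ⇒contains : ∀ {c} → c ≤ Λ A n n 0 → Contains w (incr c)
    ≤Λ⇒contains c≤ = let xs , len , chain , _ = longest n n ≤-refl ≤-refl in
      chain⇒contains w chain (≤-trans c≤ (≤-reflexive (sym len)))

  record Member (M : ℕ) (w : Permutation′ N) : Set where
    constructor member
    field
      doubly : Doubly w
      avoids : Avoids w (incr (suc M))

  open Member public

  module _ {M : ℕ} {w : Permutation′ N} (w∈ : Member M w) where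

    count-lineSums : LineSums (count w)
    count-lineSums = count-rowSum w , count-colSum w

    -- A heavier path would give an increasing subsequence of length `suc M` in the standardisation
    -- of the counts, which is `w` itself.
    count-bounded : Bounded M n (count w)
    count-bounded = ≮⇒≥ (λ M<Λ → avoids w∈
      (contains-cong (standard (count w) count-lineSums) w
                     (standard-count (count w) count-lineSums w (doubly w∈) (λ _ _ → refl))
                     (≤Λ⇒contains (count w) count-lineSums M<Λ)))

  standard-member : ∀ {M A} (L : LineSums A) → Bounded M n A → Member M (standard A L)
  standard-member {M} {A} L bounded =
    member (standard-doubly A L) λ c → <⇒≱ (contains⇒≤Λ A L c) bounded

  count-cong : ∀ {v w} → (∀ p → v ⟨$⟩ʳ p ≡ w ⟨$⟩ʳ p) → ∀ i j → count v i j ≡ count w i j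
  count-cong {v} {w} eq i j = sum-cong-≗ (λ p → indicator-cong (inCell? v i j p) (inCell? w i j p)
    (λ (a , b) → a , trans (cong block (sym (eq p))) b)
    (λ (a , b) → a , trans (cong block (eq p)) b))

-- Transfer between block sizes by the dual matrix.

module Transfer (n m₁ N₁ m₂ N₂ M : ℕ) (N₁≡ : N₁ ≡ n * suc m₁) (N₂≡ : N₂ ≡ n * suc m₂)
                (M≡ : suc m₂ + suc m₁ ≡ M) where
  private
    module S₁ = Standard n m₁ N₁ N₁≡
    module S₂ = Standard n m₂ N₂ N₂≡

  module _ {w : Permutation′ N₁} (w∈ : S₁.Member M w) where

    private
      bounded : Bounded M n (S₁.count w)
      bounded = S₁.count-bounded w∈

    -- The dual replaces each line sum `suc m₁` by `M ∸ suc m₁`, which is `suc m₂`.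
    dual-lineSums : S₂.LineSums (dual M n (S₁.count w))
    dual-lineSums =
      (λ i<n → balance (dual-rowSum M n bounded i<n) (S₁.count-rowSum w i<n)) ,
      (λ j<n → balance (dual-colSum M n bounded j<n) (S₁.count-colSum w j<n))
      where
      balance : ∀ {x y} → x + y ≡ M → y ≡ suc m₁ → x ≡ suc m₂
      balance {x} p refl = +-cancelʳ-≡ (suc m₁) x (suc m₂) (trans p (sym M≡))

    transfer : Permutation′ N₂
    transfer = S₂.standard (dual M n (S₁.count w)) dual-lineSums

    transfer-member : S₂.Member M transfer
    transfer-member = S₂.standard-member {A = dual M n (S₁.count w)} dual-lineSums (dual-bounded M n bounded)

    count-transfer : Agree n (S₂.count transfer) (dual M n (S₁.count w))
    count-transfer = S₂.count-standard (dual M n (S₁.count w)) dual-lineSums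

  transfer-cong : ∀ {v w} (a : S₁.Member M v) (b : S₁.Member M w) → (∀ p → v ⟨$⟩ʳ p ≡ w ⟨$⟩ʳ p) →
                  ∀ p → transfer a ⟨$⟩ʳ p ≡ transfer b ⟨$⟩ʳ p
  transfer-cong {v} {w} a b eq = S₂.standard-count (dual M n (S₁.count v)) (dual-lineSums a)
    (transfer b) (S₂.doubly (transfer-member b))
    (λ i<n j<n → trans
      (dual-cong M n (S₁.count-bounded b) (λ {i} {j} _ _ → S₁.count-cong {v} {w} eq i j) i<n j<n)
      (sym (count-transfer b i<n j<n)))

module _ (n m₁ N₁ m₂ N₂ M : ℕ) (N₁≡ : N₁ ≡ n * suc m₁) (N₂≡ : N₂ ≡ n * suc m₂)
         (M≡ : suc m₂ + suc m₁ ≡ M) (M≡′ : suc m₁ + suc m₂ ≡ M) where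
  private
    module S₁ = Standard n m₁ N₁ N₁≡
    module T₁ = Transfer n m₁ N₁ m₂ N₂ M N₁≡ N₂≡ M≡
    module T₂ = Transfer n m₂ N₂ m₁ N₁ M N₂≡ N₁≡ M≡′

    module S₂ = Standard n m₂ N₂ N₂≡

  -- The counts of the transferred permutation agree with the dual, so the second dual has the
  -- counts of `w`, and these determine `w`.
  transfer-transfer : ∀ {w} (a : S₁.Member M w) → ∀ p → T₂.transfer (T₁.transfer-member a) ⟨$⟩ʳ p ≡ w ⟨$⟩ʳ p
  transfer-transfer {w} a = S₁.standard-count
    (dual M n (S₂.count (T₁.transfer a))) (T₂.dual-lineSums (T₁.transfer-member a)) w (S₁.doubly a)
    (dual-dual M n (S₁.count-bounded a) (T₁.count-transfer a))

-- Conditions (L1) and (L2) in terms of blocks.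

module _ (n m : ℕ) where
  private
    k : ℕ
    k = suc m
    module W = Standard n m (n * k) refl

  block-combine : ∀ (i : Fin n) (j : Fin k) → W.block (combine i j) ≡ toℕ i
  block-combine i j = W.block-unique (toℕ<n j) (Fin.toℕ-combine i j)

  combine-< : ∀ (i : Fin n) {j j' : Fin k} → j Fin.< j' → combine i j Fin.< combine i j'
  combine-< i {j} {j'} j<j' = subst₂ _<_ (sym (Fin.toℕ-combine i j)) (sym (Fin.toℕ-combine i j'))
    (+-monoʳ-< (k * toℕ i) j<j')

  -- The comparisons of neighbours in (L1) chain up, by induction on the distance between the
  -- columns.
  inL⇒increasing : ∀ w → InL n k w → W.Increasing w
  inL⇒increasing w (rows , _) {p} {q} same p<q
    with Fin.combine-surjective {n} {k} p | Fin.combine-surjective {n} {k} q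
  ... | i , j , refl | i' , j' , refl
    with refl ← toℕ-injective (trans (sym (block-combine i j)) (trans same (block-combine i' j')))
    = go (≤⇒≤′ j<j') refl
    where
    j<j' : j Fin.< j'
    j<j' = +-cancelˡ-< (k * toℕ i) _ _ (subst₂ _<_ (Fin.toℕ-combine i j) (Fin.toℕ-combine i j') p<q)
    go : ∀ {b} {j' : Fin k} → suc (toℕ j) ≤′ b → b ≡ toℕ j' → entry w i j Fin.< entry w i j'
    go ≤′-refl       eq = rows i j _ eq
    go {j' = j'} (≤′-step {b} p) eq = <-trans (go p (sym (toℕ-fromℕ< b<k)))
      (rows i (fromℕ< b<k) j' (trans (cong suc (toℕ-fromℕ< b<k)) eq))
      where
      b<k : b < k
      b<k = <-trans (≤-reflexive eq) (toℕ<n j')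

  -- A failure of (L2) would splice w_{i,1..j+1} and w_{i+1,j..k} into an increasing
  -- subsequence of length k + 2.
  increasing⇒inL : ∀ w → W.Increasing w → Avoids w (incr (k + 2)) → InL n k w
  increasing⇒inL w inc avoids = (λ i j j' e → row i (≤-reflexive e)) , descend
    where
    row : ∀ i {j j'} → j Fin.< j' → entry w i j Fin.< entry w i j'
    row i {j} {j'} j<j' = inc (trans (block-combine i j) (sym (block-combine i j'))) (combine-< i j<j')
    row≤ : ∀ i {j j'} → j Fin.≤ j' → entry w i j Fin.≤ entry w i j'
    row≤ i {j} {j'} j≤j' with m≤n⇒m<n∨m≡n j≤j'
    ... | inj₁ lt = <⇒≤ (row i lt)
    ... | inj₂ eq = ≤-reflexive (cong (λ z → toℕ (entry w i z)) (toℕ-injective eq))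
    descend : ∀ (i i' : Fin n) (j j' : Fin k) → suc (toℕ i) ≡ toℕ i' → suc (toℕ j) ≡ toℕ j' →
              entry w i' j Fin.< entry w i j'
    descend i i' j j' i+1 j+1 with Fin.<-cmp (entry w i' j) (entry w i j')
    ... | tri< lt _ _ = lt
    ... | tri≈ _ eq _ = contradiction
      (cong toℕ (Fin.combine-injectiveˡ i' j i j' (w-injective eq)))
      (λ e → <⇒≢ (≤-reflexive i+1) (sym e))
      where
      w-injective : ∀ {p q} → w ⟨$⟩ʳ p ≡ w ⟨$⟩ʳ q → p ≡ q
      w-injective e = trans (sym (inverseˡ w)) (trans (cong (w ⟨$⟩ˡ_) e) (inverseˡ w))
    ... | tri> _ _ gt = contradiction (chain⇒contains w spliced (≤-reflexive (sym len))) avoids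
      where
      late : ∀ (t : Fin (k ∸ toℕ j)) → toℕ j + toℕ t < k
      late t = <-≤-trans (+-monoʳ-< (toℕ j) (toℕ<n t)) (≤-reflexive (m+[n∸m]≡n (<⇒≤ (toℕ<n j))))
      -- `c` runs through columns `0` to `j'` of row `i`, and `d` through columns `j` to `k - 1` of
      -- row `i'`. As `j'` is one more than `j`, this makes `k + 2` entries.
      c : Fin (suc (toℕ j')) → Fin k
      c s = Fin.inject≤ s (toℕ<n j')
      d : Fin (k ∸ toℕ j) → Fin k
      d t = fromℕ< (late t)
      c-mono : ∀ {s s'} → s Fin.< s' → c s Fin.< c s'
      c-mono {s} {s'} = subst₂ _<_ (sym (Fin.toℕ-inject≤ s _)) (sym (Fin.toℕ-inject≤ s' _))
      c≤j' : ∀ s → c s Fin.≤ j'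
      c≤j' s = ≤-trans (≤-reflexive (Fin.toℕ-inject≤ s _)) (≤-pred (toℕ<n s))
      d-mono : ∀ {t t'} → t Fin.< t' → d t Fin.< d t'
      d-mono {t} {t'} t<t' = subst₂ _<_ (sym (toℕ-fromℕ< (late t))) (sym (toℕ-fromℕ< (late t')))
                                        (+-monoʳ-< (toℕ j) t<t')
      j≤d : ∀ t → j Fin.≤ d t
      j≤d t = ≤-trans (m≤m+n (toℕ j) _) (≤-reflexive (sym (toℕ-fromℕ< (late t))))
      first last : List (Fin (n * k))
      first = tabulate (λ s → combine i (c s))
      last  = tabulate (λ t → combine i' (d t))
      spliced : AllPairs (λ p q → p Fin.< q × (w ⟨$⟩ʳ p) Fin.< (w ⟨$⟩ʳ q)) (first ++ last)
      spliced = AllPairs.++⁺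
        (AllPairs.tabulate⁺-< (λ s<s' → combine-< i (c-mono s<s') , row i (c-mono s<s')))
        (AllPairs.tabulate⁺-< (λ t<t' → combine-< i' (d-mono t<t') , row i' (d-mono t<t')))
        (All.tabulate⁺ (λ s → All.tabulate⁺ (λ t →
          Fin.combine-monoˡ-< (c s) (d t) (≤-reflexive i+1) ,
          ≤-<-trans (row≤ i (c≤j' s)) (<-≤-trans gt (row≤ i' (j≤d t))))))
      len : length (first ++ last) ≡ k + 2
      len = begin
        length (first ++ last)            ≡⟨ length-++ first ⟩
        length first + length last        ≡⟨ cong₂ _+_ (length-tabulate (λ s → combine i (c s)))
                                                       (length-tabulate (λ t → combine i' (d t))) ⟩
        suc (toℕ j') + (k ∸ toℕ j)        ≡⟨ cong (λ z → suc z + (k ∸ toℕ j)) (sym j+1) ⟩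
        2 + (toℕ j + (k ∸ toℕ j))         ≡⟨ cong (2 +_) (m+[n∸m]≡n (<⇒≤ (toℕ<n j))) ⟩
        2 + k                             ≡⟨ +-comm 2 k ⟩
        k + 2                             ∎
        where open ≡-Reasoning

theorem5p2 : (n k : ℕ) → 1 ≤ n → 1 ≤ k → Inverse (LInvSet n k) (SAvoid n k)
theorem5p2 n (suc m) _ _ = record
  { to        = λ (w , w∈) → T.transfer (fromL w w∈) , S.avoids (T.transfer-member (fromL w w∈))
  ; from      = λ (σ , σ∈) → T′.transfer (fromS σ σ∈) , toL _ (T′.transfer-member (fromS σ σ∈))
  ; to-cong   = λ { {v , v∈} {w , w∈} → T.transfer-cong (fromL v v∈) (fromL w w∈) }
  ; from-cong = λ { {σ , σ∈} {τ , τ∈} → T′.transfer-cong (fromS σ σ∈) (fromS τ τ∈) }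
  ; inverse   =
      (λ { {σ , σ∈} {w , w∈} eq p → trans
        (T.transfer-cong (fromL w w∈) (T′.transfer-member (fromS σ σ∈)) eq p)
        (transfer-transfer n 0 n m (n * suc m) M n≡ refl M≡′ M≡ (fromS σ σ∈) p) }) ,
      (λ { {w , w∈} {σ , σ∈} eq p → trans
        (T′.transfer-cong (fromS σ σ∈) (T.transfer-member (fromL w w∈)) eq p)
        (transfer-transfer n m (n * suc m) 0 n M refl n≡ M≡ M≡′ (fromL w w∈) p) })
  }
  where
  -- With `k = suc m` this is `k + 1`, written so that `suc M` is definitionally the pattern length
  -- `suc m + 2`.
  M = m + 2
  M≡ : 1 + suc m ≡ M
  M≡ = +-comm 2 m
  M≡′ : suc m + 1 ≡ M
  M≡′ = sym (+-suc m 1)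
  n≡ : n ≡ n * 1
  n≡ = sym (*-identityʳ n)
  module W  = Standard n m (n * suc m) refl
  module S  = Standard n 0 n n≡
  module T  = Transfer n m (n * suc m) 0 n M refl n≡ M≡
  module T′ = Transfer n 0 n m (n * suc m) M n≡ refl M≡′
  InLInv : Permutation′ (n * suc m) → Set
  InLInv w = (InL n (suc m) w × Avoids w (incr (suc m + 2))) ×
             (InL n (suc m) (w ⁻¹) × Avoids (w ⁻¹) (incr (suc m + 2)))
  fromL : ∀ w → InLInv w → W.Member M w
  fromL w ((inL , avoids) , inL⁻¹ , _) =
    W.member (inL⇒increasing n m w inL , inL⇒increasing n m (w ⁻¹) inL⁻¹) avoids
  toL : ∀ w → W.Member M w → InLInv w
  toL w (W.member (inc , inc⁻¹) avoids) =
    (increasing⇒inL n m w inc avoids , avoids) ,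
    (increasing⇒inL n m (w ⁻¹) inc⁻¹ avoids⁻¹ , avoids⁻¹)
    where
    avoids⁻¹ : Avoids (w ⁻¹) (incr (suc m + 2))
    avoids⁻¹ = avoids ∘ contains-flip w
  -- Blocks have size one here, so no two distinct positions share a block.
  trivial : ∀ σ → S.Increasing σ
  trivial σ {p} {q} same p<q =
    contradiction (trans (sym (n/1≡n (toℕ p))) (trans same (n/1≡n (toℕ q)))) (<⇒≢ p<q)
  fromS : ∀ σ → Avoids σ (incr (suc m + 2)) → S.Member M σ
  fromS σ avoids = S.member (trivial σ , trivial (flip σ)) avoids
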